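{- Let $G$ be a VPT graph and let $h\geq 3$. If $G$ is a minimal non $[h,2,1]$ graph, then $G\in[h+1,2,1]$.
   Context: All graphs are finite, simple and connected. A VPT representation of $G$ is a tree $T$ (the host tree) together with paths $(P_v)_{v\in V(G)}$ of $T$ such that $uv\in E(G)$ iff $P_u$ and $P_v$ share at least one vertex; $G$ is VPT if it has such a representation. For an integer $h$, $[h,2,1]$ is the class of graphs admitting a VPT representation whose host tree has maximum degree at most $h$. A minimal non $[h,2,1]$ graph is a graph $G$ with $G\notin[h,2,1]$ and $G-v\in[h,2,1]$ for every $v\in V(G)$. -}

module Defs where

open import Data.Nat using (ℕ; zero; suc; _≤_; _≥_)
open import Data.Bool using (Bool; true; false)
open import Data.Fin using (Fin; punchIn)
open import Data.List using (List; []; _∷_; length; filterᵇ; allFin; last)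
open import Data.List.Membership.Propositional using (_∈_)
open import Data.List.Relation.Unary.Unique.Propositional using (Unique)
open import Data.List.Relation.Unary.Linked using (Linked)
open import Data.Maybe using (just)
open import Data.Product using (Σ; ∃; _×_)
open import Relation.Binary.PropositionalEquality using (_≡_; _≢_)
open import Relation.Nullary using (¬_)
open import Function.Bundles using (_⇔_)

Graph : ℕ → Set
Graph n = Fin n → Fin n → Bool

Adj : ∀ {n} → Graph n → Fin n → Fin n → Set
Adj G u v = G u v ≡ true

record IsSimple {n : ℕ} (G : Graph n) : Set where
  field
    irrefl : ∀ v → G v v ≡ false
    sym    : ∀ u v → G u v ≡ G v u

data Reach {n : ℕ} (G : Graph n) : Fin n → Fin n → Set where
  here : ∀ {u} → Reach G u u
  step : ∀ {u v w} → Adj G u v → Reach G v w → Reach G u w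

Connected : ∀ {n} → Graph n → Set
Connected G = ∀ u v → Reach G u v

IsCycle : ∀ {n} → Graph n → List (Fin n) → Set
IsCycle G [] = Data.Empty.⊥ where import Data.Empty
IsCycle G (x ∷ xs) =
  (3 ≤ length (x ∷ xs)) × Unique (x ∷ xs) × Linked (Adj G) (x ∷ xs)
  × Σ (Fin _) (λ y → (last (x ∷ xs) ≡ just y) × Adj G y x)

Acyclic : ∀ {n} → Graph n → Set
Acyclic G = ∀ xs → ¬ IsCycle G xs

record Tree : Set where
  field
    size     : ℕ
    adj      : Graph size
    simple   : IsSimple adj
    connected : Connected adj
    acyclic  : Acyclic adj

degree : ∀ {n} → Graph n → Fin n → ℕ
degree {n} G x = length (filterᵇ (G x) (allFin n))

MaxDegreeAtMost : ℕ → Tree → Set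
MaxDegreeAtMost h T = ∀ x → degree (Tree.adj T) x ≤ h

IsPath : ∀ {m} → Graph m → List (Fin m) → Set
IsPath G [] = Data.Empty.⊥ where import Data.Empty
IsPath G (x ∷ xs) = Unique (x ∷ xs) × Linked (Adj G) (x ∷ xs)

record VPTRep {n : ℕ} (G : Graph n) (T : Tree) : Set where
  field
    path    : Fin n → List (Fin (Tree.size T))
    isPath  : ∀ v → IsPath (Tree.adj T) (path v)
    edges   : ∀ u v → u ≢ v →
              (Adj G u v ⇔ ∃ (λ x → (x ∈ path u) × (x ∈ path v)))

VPT : ∀ {n} → Graph n → Set
VPT G = Σ Tree (λ T → VPTRep G T)

InClass : ℕ → ∀ {n} → Graph n → Set
InClass h G = Σ Tree (λ T → MaxDegreeAtMost h T × VPTRep G T)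

delete : ∀ {k} → Graph (suc k) → Fin (suc k) → Graph k
delete G v i j = G (punchIn v i) (punchIn v j)

MinimalNon : ℕ → ∀ {k} → Graph (suc k) → Set
MinimalNon h G = ¬ InClass h G × (∀ v → InClass h (delete G v))

module Submission where

-- A path of the host tree is stored by its two end nodes, and the tree by its routing table:
-- hop w c is the neighbour of w towards c, so that w lies between a and b unless hop w a = hop w b.
--
-- Take a representation of minimal total path length. If x is on some path and z is a neighbour of x,
-- then some path contains x but not z; otherwise x could be contracted into z. Hence the set Cₓ of
-- vertices whose path contains x, when nonempty, is a maximal clique, and every neighbour i of x that
-- is on some path is on the path of some uᵢ ∉ Cₓ. Let two neighbours of x conflict when a path passes
-- through both. Fix v ∉ Cₓ and a representation of G - v of maximum degree h. By the Helly property
-- some node x' lies on all paths of Cₓ there. Colour i by the branch at x' that holds the path of uᵢ,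
-- with one extra colour for the i whose branch holds v. If i and j conflict and get the same colour,
-- the paths of Cₓ through i all pass through j or vice versa; then one of i, j has no other conflict
-- and is recoloured. So h + 1 colours suffice at every node. Neighbours of x of equal colour can be
-- moved to a new neighbour of x, of degree 3, without changing intersections; repeating this bounds
-- all degrees by h + 1.

open import Defs
open import Data.Bool using (if_then_else_; T?)
open import Data.Bool.Properties using (T-≡)
open import Data.Empty using (⊥; ⊥-elim)
open import Data.Fin as Fin using (Fin; zero; suc; _≟_; punchIn; punchOut; inject≤)
open import Data.Fin.Properties
  using (suc-injective; any?; all?; ¬∀⟶∃¬; punchIn-injective; punchIn-punchOut; inject≤-injective;
         injective⇒≤; <-asym; ≤-antisym)
open import Data.List
  using (List; []; _∷_; length; last; map; lookup; filter; filterᵇ; cartesianProduct; allFin)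
open import Data.List.Membership.DecPropositional using (_∈?_)
open import Data.List.Membership.Propositional using (_∈_; _∉_; lose)
open import Data.List.Membership.Propositional.Properties
  using (∈-allFin; ∈-cartesianProduct⁺; ∈-filter⁺; ∈-filter⁻; ∈-lookup; ∈-map⁺)
open import Data.List.Properties using (filter-notAll; length-map)
open import Data.List.Relation.Unary.All as All using (All; []; _∷_)
import Data.List.Relation.Unary.All.Properties as All
open import Data.List.Relation.Unary.AllPairs using ([]; _∷_)
open import Data.List.Relation.Unary.Any using (Any; here; there; index)
open import Data.List.Relation.Unary.Any.Properties using (lookup-index)
open import Data.List.Relation.Unary.Linked as Linked using (Linked; [-]; _∷_)
open import Data.List.Relation.Unary.Unique.Propositional using (Unique)
open import Data.List.Relation.Unary.Unique.Propositional.Properties using (allFin⁺; filter⁺)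
open import Data.Maybe using (just; nothing)
open import Data.Nat using (ℕ; zero; suc; _≤_; _<_; _≥_; z≤n; s≤s; s≤s⁻¹)
open import Data.Nat.Properties using (≤-refl; ≤-trans; ≤-reflexive; m≤n⇒m≤1+n; n≮0; ≮⇒≥)
open import Data.Product using (Σ; ∃; _×_; _,_; proj₁; proj₂)
open import Data.Sum as Sum using (_⊎_; inj₁; inj₂; [_,_]′)
open import Data.Unit using (⊤; tt)
open import Function.Base using (_∘_; id)
open import Function.Bundles using (_⇔_; mk⇔; Equivalence)
open import Relation.Binary.Construct.Closure.ReflexiveTransitive as Star
  using (Star; ε; _◅_; _◅◅_)
open import Relation.Binary.PropositionalEquality
open import Relation.Nullary using (¬_; Dec; yes; no)
open import Relation.Nullary.Decidable
  using (does; dec-true; dec-false; ¬?; _×-dec_; _⊎-dec_; _→-dec_)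
open import Relation.Unary using (Decidable)

-- Routing tables of trees

record RTree (n : ℕ) : Set₁ where
  field
    E        : Fin n → Fin n → Set
    hop      : Fin n → Fin n → Fin n
    E-sym    : ∀ {u w} → E u w → E w u
    E-irr    : ∀ {u w} → E u w → u ≢ w
    hop-self : ∀ w → hop w w ≡ w
    hop-E    : ∀ {w c} → c ≢ w → E w (hop w c)
    hop-nbr  : ∀ {w i} → E w i → hop w i ≡ i
    -- The branches at `w` are the components that remain when `w` is removed. Together with
    -- `hop-nbr`, which keeps distinct neighbours in distinct branches, this rules out cycles.
    hop-step : ∀ {w c d} → E c d → c ≢ w → d ≢ w → hop w c ≡ hop w d
    walk     : ∀ u w → Star E u w

  -- The premise also holds when `a` and `b` are both `w`, hence the conclusion `a ≡ w` in place of
  -- falsity.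
  Mem : Fin n → Fin n → Fin n → Set
  Mem w a b = hop w a ≡ hop w b → a ≡ w

  Mem? : ∀ w a b → Dec (Mem w a b)
  Mem? w a b = (hop w a ≟ hop w b) →-dec (a ≟ w)

  hop≡self : ∀ {w c} → hop w c ≡ w → c ≡ w
  hop≡self {w} {c} eq with c ≟ w
  ... | yes c≡w = c≡w
  ... | no  c≢w = ⊥-elim (E-irr (hop-E c≢w) (sym eq))

  ¬Mem⇒ : ∀ {w a b} → ¬ Mem w a b → (hop w a ≡ hop w b) × a ≢ w
  ¬Mem⇒ {w} {a} {b} ¬m with hop w a ≟ hop w b
  ... | yes eq = eq , λ a≡w → ¬m λ _ → a≡w
  ... | no  ne = ⊥-elim (¬m λ eq → ⊥-elim (ne eq))

  Mem-sym : ∀ {w a b} → Mem w a b → Mem w b a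
  Mem-sym {w} m eq = hop≡self (trans eq (trans (cong (hop w) (m (sym eq))) (hop-self w)))

  -- On a walk from `c` to `g` the second alternative holds at the end, and `hop-step` carries
  -- either alternative back across every edge that avoids `g` and `p`.
  hop-opposite : ∀ {g p} → g ≢ p → ∀ c → hop g c ≡ hop g p ⊎ hop p c ≡ hop p g
  hop-opposite {g} {p} g≢p c = go (walk c g)
    where
    go : ∀ {c} → Star E c g → hop g c ≡ hop g p ⊎ hop p c ≡ hop p g
    go ε = inj₂ refl
    go {c} (_◅_ {j = d} e es) with c ≟ g | c ≟ p | d ≟ g | d ≟ p
    ... | yes refl | _ | _ | _ = inj₂ refl
    ... | no _ | yes refl | _ | _ = inj₁ refl
    ... | no _ | no c≢p | yes refl | _ = inj₂ (hop-step e c≢p g≢p)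
    ... | no c≢g | no _ | no d≢g | yes refl = inj₁ (hop-step e c≢g d≢g)
    ... | no c≢g | no c≢p | no d≢g | no d≢p with go es
    ...   | inj₁ eq = inj₁ (trans (hop-step e c≢g d≢g) eq)
    ...   | inj₂ eq = inj₂ (trans (hop-step e c≢p d≢p) eq)

  -- A walk from `c` to `w` preserves both equations until it reaches `w` or `w'`; by `hop-nbr` the
  -- node before would have to be the other of the two.
  hop-exclusive : ∀ {w w'} → E w w' → ∀ {c} → hop w c ≡ w' → hop w' c ≢ w
  hop-exclusive {w} {w'} ww' {c} = go (walk c w)
    where
    w≢w' = E-irr ww'
    go : ∀ {c} → Star E c w → hop w c ≡ w' → hop w' c ≢ w
    go ε p q = w≢w' (trans (sym (hop-self w)) p)
    go {c} (_◅_ {j = d} e es) p q with c ≟ w | c ≟ w' | d ≟ w | d ≟ w'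
    ... | yes refl | _ | _ | _ = w≢w' (trans (sym (hop-self w)) p)
    ... | no _ | yes refl | _ | _ = w≢w' (trans (sym q) (hop-self w'))
    ... | no _ | no c≢w' | yes refl | _ = c≢w' (trans (sym (hop-nbr (E-sym e))) p)
    ... | no c≢w | no _ | no _ | yes refl = c≢w (trans (sym (hop-nbr (E-sym e))) q)
    ... | no c≢w | no c≢w' | no d≢w | no d≢w' =
      go es (trans (sym (hop-step e c≢w d≢w)) p) (trans (sym (hop-step e c≢w' d≢w')) q)

  -- Otherwise `hop-opposite` puts both `a` and `b` on the side of `g` as seen from `p`, and then
  -- `p` is on the path only by being the end `a`.
  hop-of-Mem : ∀ {g p a b} → Mem p a b → p ≢ g → hop g p ≡ hop g a ⊎ hop g p ≡ hop g b
  hop-of-Mem {g} {p} {a} {b} m p≢g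
    with hop-opposite (λ g≡p → p≢g (sym g≡p)) a | hop-opposite (λ g≡p → p≢g (sym g≡p)) b
  ... | inj₁ eq | _ = inj₁ (sym eq)
  ... | inj₂ _ | inj₁ eq = inj₂ (sym eq)
  ... | inj₂ eqa | inj₂ eqb = inj₁ (cong (hop g) (sym (m (trans eqa (sym eqb)))))

  -- If `a` and `b` were in the same branch at `g`, `hop-of-Mem` would put `p` and `q` there too,
  -- although `g` is between them.
  Mem-convex : ∀ {g p q a b} → Mem g p q → Mem p a b → Mem q a b → Mem g a b
  Mem-convex {g} {p} {q} {a} {b} gpq pab qab eq with p ≟ g | q ≟ g
  ... | yes refl | _ = pab eq
  ... | no _ | yes refl = qab eq
  ... | no p≢g | no q≢g = ⊥-elim (p≢g (gpq (trans (toa pab p≢g) (sym (toa qab q≢g)))))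
    where
    toa : ∀ {s} → Mem s a b → s ≢ g → hop g s ≡ hop g a
    toa m s≢g = [ (λ e → e) , (λ e → trans e (sym eq)) ]′ (hop-of-Mem m s≢g)

  -- Seen from the neighbour `hop x a`, the end `b` lies back through `x`, whereas `a` does not, by
  -- `hop-exclusive`.
  Mem-hop : ∀ {x a b} → Mem x a b → a ≢ x → Mem (hop x a) a b
  Mem-hop {x} {a} {b} m a≢x eq with hop-opposite (E-irr xi) b
    where xi = hop-E a≢x
  ... | inj₁ p = ⊥-elim (a≢x (m (sym (trans p (hop-nbr (hop-E a≢x))))))
  ... | inj₂ p = ⊥-elim (hop-exclusive (hop-E a≢x) refl
                   (trans eq (trans p (hop-nbr (E-sym (hop-E a≢x))))))

  -- Recursion along a walk from `w` to `a`. If `w` is off the path, the median `g` of the next node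
  -- `w'` serves `w` too: it could fail only if `w'` is `g` and `w` is the next node from `g`
  -- towards an end, and then `Mem-hop` would put `w` on the path.
  median : ∀ w a b → Σ (Fin n) λ g → Mem g a b × Mem g w a × Mem g w b
  median w a b = go (walk w a)
    where
    go : ∀ {w} → Star E w a → Σ (Fin n) λ g → Mem g a b × Mem g w a × Mem g w b
    go ε = a , (λ _ → refl) , (λ _ → refl) , (λ _ → refl)
    go {w} (_◅_ {j = w'} e es) with go es | Mem? w a b
    ... | _ | yes m = w , m , (λ _ → refl) , (λ _ → refl)
    ... | g , gab , gwa , gwb | no ¬m = g , gab , side gab ¬m gwa , side (Mem-sym gab) (λ m → ¬m (Mem-sym m)) gwb
      where
      w≢g : w ≢ g
      w≢g refl = ¬m gab
      side : ∀ {p q} → Mem g p q → ¬ Mem w p q → Mem g w' p → Mem g w p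
      side {p} {q} gpq ¬wpq gw'p eq with w' ≟ g
      ... | no w'≢g = ⊥-elim (w'≢g (gw'p (trans (sym (hop-step e w≢g w'≢g)) eq)))
      ... | yes refl = ⊥-elim (¬wpq (subst (λ s → Mem s p q) w'p≡w (Mem-hop gpq p≢w')))
        where
        w'p≡w : hop w' p ≡ w
        w'p≡w = trans (sym eq) (hop-nbr (E-sym e))
        p≢w' : p ≢ w'
        p≢w' p≡w' = w≢g (trans (sym w'p≡w) (trans (cong (hop w') p≡w') (hop-self w')))

  -- `g` is the gate of the path as seen from `w`: any other node of the path lies from `g` towards
  -- `a` or `b`, and `w` lies in neither direction.
  Mem-gate : ∀ {g w a b q} → Mem g w a → Mem g w b → Mem q a b → Mem g w q
  Mem-gate {g} {w} {a} {b} {q} gwa gwb qab eq with q ≟ g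
  ... | yes refl = hop≡self (trans eq (hop-self g))
  ... | no q≢g with hop-of-Mem qab q≢g
  ...   | inj₁ p = gwa (trans eq p)
  ...   | inj₂ p = gwb (trans eq p)

  -- If the median `g` differs from all three nodes, each lies from `g` towards `a` or `b`; two
  -- share a direction, although `g` is between them.
  Mem-collinear : ∀ {p q s a b} → Mem p a b → Mem q a b → Mem s a b →
                  Mem p q s ⊎ Mem q p s ⊎ Mem s p q
  Mem-collinear {p} {q} {s} {a} {b} pab qab sab with median p q s
  ... | g , gqs , gpq , gps with p ≟ g | q ≟ g | s ≟ g
  ... | yes refl | _ | _ = inj₁ gqs
  ... | no _ | yes refl | _ = inj₂ (inj₁ gps)
  ... | no _ | no _ | yes refl = inj₂ (inj₂ gpq)
  ... | no p≢g | no q≢g | no s≢g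
      with hop-of-Mem pab p≢g | hop-of-Mem qab q≢g | hop-of-Mem sab s≢g
  ... | inj₁ x | inj₁ y | _ = ⊥-elim (p≢g (gpq (trans x (sym y))))
  ... | inj₂ x | inj₂ y | _ = ⊥-elim (p≢g (gpq (trans x (sym y))))
  ... | inj₁ x | inj₂ _ | inj₁ y = ⊥-elim (p≢g (gps (trans x (sym y))))
  ... | inj₂ x | inj₁ _ | inj₂ y = ⊥-elim (p≢g (gps (trans x (sym y))))
  ... | inj₁ _ | inj₂ x | inj₂ y = ⊥-elim (q≢g (gqs (trans x (sym y))))
  ... | inj₂ _ | inj₁ x | inj₁ y = ⊥-elim (q≢g (gqs (trans x (sym y))))

  -- Induction on the list: the common node `w` so far is replaced by its gate `g` on the next path.
  -- An earlier path contains `w` and meets the next path at some `q`, and `g` lies between `w` and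
  -- `q`.
  helly : ∀ {V : Set} (a b : V → Fin n) → Fin n → (C : List V) →
          (∀ {u v} → u ∈ C → v ∈ C → ∃ λ q → Mem q (a u) (b u) × Mem q (a v) (b v)) →
          ∃ λ w → ∀ {v} → v ∈ C → Mem w (a v) (b v)
  helly a b t [] meet = t , λ ()
  helly a b t (v ∷ C) meet with helly a b t C (λ p q → meet (there p) (there q))
  ... | w , w∈ with median w (a v) (b v)
  ... | g , gv , gwa , gwb = g , λ
    { (here refl) → gv
    ; (there u∈) → let q , qu , qv = meet (there u∈) (here refl) in
                   Mem-convex (Mem-gate gwa gwb qv) (w∈ u∈) qu }

-- Conversion of host trees

record SimplePath {n} (R : Fin n → Fin n → Set) (Q : Fin n → Set) (a b : Fin n) : Set where
  constructor simplePath
  field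
    tail   : List (Fin n)
    unique : Unique (a ∷ tail)
    linked : Linked R (a ∷ tail)
    ends   : last (a ∷ tail) ≡ just b
    all    : All Q (a ∷ tail)

module _ {n : ℕ} {R : Fin n → Fin n → Set} {Q : Fin n → Set} where

  suffixFrom : ∀ {c b} xs → c ∈ xs → Unique xs → Linked R xs → last xs ≡ just b → All Q xs →
               SimplePath R Q c b
  suffixFrom (_ ∷ xs) (here refl) u l e q = simplePath xs u l e q
  suffixFrom (_ ∷ x ∷ xs) (there c∈) (_ ∷ u) (_ ∷ l) e (_ ∷ q) = suffixFrom (x ∷ xs) c∈ u l e q

  eraseLoops : ∀ {a b} → Q b → Star (λ u w → R u w × Q u) a b → SimplePath R Q a b
  eraseLoops qb ε = simplePath [] ([] ∷ []) [-] refl (qb ∷ [])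
  eraseLoops {a} qb (_◅_ {j = c} (r , qa) es) with eraseLoops qb es
  ... | simplePath t u l e q with _∈?_ _≟_ a (c ∷ t)
  ...   | yes a∈ = suffixFrom (c ∷ t) a∈ u l e q
  ...   | no  a∉ = simplePath (c ∷ t) (All.¬Any⇒All¬ _ a∉ ∷ u) (r ∷ l) e (qa ∷ q)

module FromTree (T : Tree) where
  open Tree T
  open IsSimple simple renaming (sym to adj-sym)

  private
    V = Fin size

  Avoid : V → V → V → Set
  Avoid w u v = (Adj adj u v × u ≢ w) × v ≢ w

  flip : ∀ {u v} → Adj adj u v → Adj adj v u
  flip {u} {v} = trans (adj-sym v u)

  irr : ∀ {u v} → Adj adj u v → u ≢ v
  irr {u} e refl with trans (sym e) (irrefl u)
  ... | ()

  rev : ∀ {w u v} → Star (Avoid w) u v → Star (Avoid w) v u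
  rev = Star.reverse λ ((e , p) , q) → (flip e , q) , p

  -- Two neighbours of w joined outside w would close a cycle through w.
  neighbour-unique : ∀ {w i j} → Adj adj w i → Adj adj w j → Star (Avoid w) i j → i ≡ j
  neighbour-unique {w} {i} {j} wi wj es
    with eraseLoops {R = Adj adj} {Q = _≢ w} (irr (flip wj)) (Star.map proj₁ es)
  ... | simplePath [] _ _ refl _ = refl
  ... | simplePath (k ∷ t) u l e q = ⊥-elim (acyclic (w ∷ i ∷ k ∷ t)
          ( s≤s (s≤s (s≤s z≤n))
          , All.map (λ ne → ne ∘ sym) q ∷ u
          , wi ∷ l
          , j , e , flip wj))

  firstHop : ∀ {w c} → Reach adj c w → c ≢ w → Σ V λ h → Adj adj w h × Star (Avoid w) c h
  firstHop here c≢w = ⊥-elim (c≢w refl)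
  firstHop {w} {c} (step {v = d} e es) c≢w with d ≟ w
  ... | yes refl = c , flip e , ε
  ... | no d≢w with firstHop es d≢w
  ...   | h , wh , s = h , wh , ((e , c≢w) , d≢w) ◅ s

  hop : V → V → V
  hop w c with c ≟ w
  ... | yes _  = w
  ... | no c≢w = proj₁ (firstHop (connected c w) c≢w)

  hop-spec : ∀ {w c} → c ≢ w → Adj adj w (hop w c) × Star (Avoid w) c (hop w c)
  hop-spec {w} {c} c≢w with c ≟ w
  ... | yes c≡w = ⊥-elim (c≢w c≡w)
  ... | no c≢w' = proj₂ (firstHop (connected c w) c≢w')

  toRTree : RTree size
  toRTree = record
    { E        = Adj adj
    ; hop      = hop
    ; E-sym    = flip
    ; E-irr    = irr
    ; hop-self = self
    ; hop-E    = λ c≢w → proj₁ (hop-spec c≢w)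
    ; hop-nbr  = λ wi → let wh , s = hop-spec (irr (flip wi)) in sym (neighbour-unique wi wh s)
    ; hop-step = λ e c≢w d≢w →
        let wh , s = hop-spec c≢w ; wh' , s' = hop-spec d≢w in
        neighbour-unique wh wh' (rev s ◅◅ ((e , c≢w) , d≢w) ◅ s')
    ; walk     = λ u w → toStar (connected u w)
    }
    where
    self : ∀ w → hop w w ≡ w
    self w with w ≟ w
    ... | yes _ = refl
    ... | no ne = ⊥-elim (ne refl)
    toStar : ∀ {u w} → Reach adj u w → Star (Adj adj) u w
    toStar here = ε
    toStar (step e es) = e ◅ toStar es

module _ {n : ℕ} (T : RTree n) where
  open RTree T

  private
    last∈ : ∀ {b : Fin n} x xs → last (x ∷ xs) ≡ just b → b ∈ x ∷ xs
    last∈ x [] refl = here refl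
    last∈ x (y ∷ ys) e = there (last∈ y ys e)

  hop-avoiding : ∀ {w b} x xs → Linked E (x ∷ xs) → w ∉ x ∷ xs → last (x ∷ xs) ≡ just b →
                 hop w x ≡ hop w b
  hop-avoiding x [] _ _ refl = refl
  hop-avoiding {w} x (y ∷ ys) (e ∷ l) w∉ lst =
    trans (hop-step e (λ x≡w → w∉ (here (sym x≡w))) (λ y≡w → w∉ (there (here (sym y≡w)))))
          (hop-avoiding y ys l (λ p → w∉ (there p)) lst)

  Mem⇒∈ : ∀ {w b} x xs → Linked E (x ∷ xs) → last (x ∷ xs) ≡ just b → Mem w x b → w ∈ x ∷ xs
  Mem⇒∈ {w} x xs l lst m with _∈?_ _≟_ w (x ∷ xs)
  ... | yes w∈ = w∈
  ... | no w∉ = ⊥-elim (w∉ (here (sym (m (hop-avoiding x xs l w∉ lst)))))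

  -- Where `w` is met, its predecessor and successor in the list are distinct neighbours of `w`, and
  -- each gives the direction of its own end of the path.
  ∈⇒Mem : ∀ {w b} x xs → Unique (x ∷ xs) → Linked E (x ∷ xs) → last (x ∷ xs) ≡ just b →
          w ∈ x ∷ xs → Mem w x b
  ∈⇒Mem x xs _ _ _ (here refl) _ = refl
  ∈⇒Mem {w} x (y ∷ ys) (x∉ ∷ u) (e ∷ l) lst (there w∈) eq with w ≟ x | y ≟ w
  ... | yes w≡x | _ = sym w≡x
  ... | no w≢x | no y≢w =
    ⊥-elim (y≢w (∈⇒Mem y ys u l lst w∈ (trans (sym (hop-step e (w≢x ∘ sym) y≢w)) eq)))
  ... | no w≢x | yes refl with ys | u | l | lst
  ...   | [] | _ | _ | refl = ⊥-elim (E-irr e (trans (sym (hop-nbr (E-sym e))) (trans eq (hop-self w))))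
  ...   | z ∷ zs | y∉ ∷ _ | e' ∷ l' | lst' =
    ⊥-elim (All.lookup x∉ (there (here refl)) (trans (sym (hop-nbr (E-sym e)))
      (trans eq (trans (sym (hop-avoiding z zs l' (All.All¬⇒¬Any y∉) lst')) (hop-nbr e')))))

  -- The table determines adjacency: the neighbours of `w` are the other nodes fixed by `hop w`.
  E? : ∀ w i → Dec (E w i)
  E? w i with i ≟ w | hop w i ≟ i
  ... | yes refl | _ = no λ e → E-irr e refl
  ... | no i≢w | yes eq = yes (subst (E w) eq (hop-E i≢w))
  ... | no _ | no ne = no λ e → ne (hop-nbr e)

  graph : Graph n
  graph w i = does (E? w i)

  E⇒Adj : ∀ {w i} → E w i → Adj graph w i
  E⇒Adj {w} {i} e = dec-true (E? w i) e

  Adj⇒E : ∀ {w i} → Adj graph w i → E w i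
  Adj⇒E {w} {i} eq with E? w i
  ... | yes e = e

  toTree : Tree
  toTree = record
    { size      = n
    ; adj       = graph
    ; simple    = record
      { irrefl = λ v → dec-false (E? v v) λ e → E-irr e refl
      ; sym    = λ u v → gsym u v }
    ; connected = λ u w → toReach (walk u w)
    ; acyclic   = acyclic
    }
    where
    gsym : ∀ u v → graph u v ≡ graph v u
    gsym u v with E? u v
    ... | yes e = sym (dec-true (E? v u) (E-sym e))
    ... | no ne = sym (dec-false (E? v u) (ne ∘ E-sym))
    toReach : ∀ {u w} → Star E u w → Reach graph u w
    toReach ε = here
    toReach (e ◅ es) = step (E⇒Adj e) (toReach es)
    acyclic : Acyclic graph
    acyclic (x ∷ []) (s≤s () , _)
    acyclic (x ∷ _ ∷ []) (s≤s (s≤s ()) , _)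
    -- The rest of the cycle avoids `x`, so `y` and the last node `b` share a branch at `x`. Both
    -- are neighbours of `x`, hence equal, and the cycle repeats a node.
    acyclic (x ∷ y ∷ z ∷ zs) (_ , x∉ ∷ y∉ ∷ _ , xy ∷ l , b , lst , bx) =
      All.All¬⇒¬Any y∉ (subst (_∈ z ∷ zs) b≡y (last∈ z zs lst))
      where
      b≡y : b ≡ y
      b≡y = trans (sym (hop-nbr (E-sym (Adj⇒E bx))))
        (trans (sym (hop-avoiding y (z ∷ zs) (Linked.map Adj⇒E l) (All.All¬⇒¬Any x∉) lst))
               (hop-nbr (Adj⇒E xy)))

-- Representations by pairs of end nodes.

record Rep {N} (G : Graph N) {n} (T : RTree n) : Set where
  open RTree T
  field
    a b   : Fin N → Fin n
    edges : ∀ u v → u ≢ v →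
            Adj G u v ⇔ ∃ λ q → Mem q (a u) (b u) × Mem q (a v) (b v)

  In : Fin N → Fin n → Set
  In v w = Mem w (a v) (b v)

  In? : ∀ v w → Dec (In v w)
  In? v w = Mem? w (a v) (b v)

fromVPT : ∀ {N} {G : Graph N} (T : Tree) → VPTRep G T → Rep G (FromTree.toRTree T)
fromVPT {N} {G} T R = record
  { a = λ v → proj₁ (ends v)
  ; b = λ v → proj₁ (proj₂ (ends v))
  ; edges = λ u v u≢v → mk⇔
      (λ uv → let q , qu , qv = Equivalence.to (edges u v u≢v) uv in q , to u qu , to v qv)
      (λ (q , qu , qv) → Equivalence.from (edges u v u≢v) (q , from u qu , from v qv))
  }
  where
  open VPTRep R
  T' = FromTree.toRTree T
  open RTree T'
  Ends : List (Fin (Tree.size T)) → Set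
  Ends xs = ∃ λ a → ∃ λ b → (∀ {w} → w ∈ xs → Mem w a b) × (∀ {w} → Mem w a b → w ∈ xs)
  endsOf : ∀ xs → IsPath (Tree.adj T) xs → Ends xs
  endsOf (x ∷ xs) (u , l) with last (x ∷ xs) in eq
  ... | just b = x , b , ∈⇒Mem T' x xs u l eq , Mem⇒∈ T' x xs l eq
  ... | nothing = ⊥-elim (last≢nothing x xs eq)
    where
    last≢nothing : ∀ {A : Set} (x : A) xs → last (x ∷ xs) ≢ nothing
    last≢nothing x (y ∷ ys) = last≢nothing y ys
  ends : ∀ v → Ends (path v)
  ends v = endsOf (path v) (isPath v)
  to : ∀ v {w} → w ∈ path v → Mem w (proj₁ (ends v)) (proj₁ (proj₂ (ends v)))
  to v = proj₁ (proj₂ (proj₂ (ends v)))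
  from : ∀ v {w} → Mem w (proj₁ (ends v)) (proj₁ (proj₂ (ends v))) → w ∈ path v
  from v = proj₂ (proj₂ (proj₂ (ends v)))

toVPT : ∀ {N} {G : Graph N} {n} {T : RTree n} → Rep G T → VPTRep G (toTree T)
toVPT {N} {G} {n} {T} R = record
  { path   = λ v → a v ∷ tail (sp v)
  ; isPath = λ v → unique (sp v) , Linked.map (E⇒Adj T) (linked (sp v))
  ; edges  = λ u v u≢v → mk⇔
      (λ uv → let q , qu , qv = Equivalence.to (edges u v u≢v) uv in q , from u qu , from v qv)
      (λ (q , qu , qv) → Equivalence.from (edges u v u≢v) (q , to u qu , to v qv))
  }
  where
  open RTree T
  open Rep R
  open SimplePath
  sp : ∀ v → SimplePath E (λ _ → ⊤) (a v) (b v)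
  sp v = eraseLoops tt (Star.map (_, tt) (walk (a v) (b v)))
  to : ∀ v {w} → w ∈ a v ∷ tail (sp v) → In v w
  to v = ∈⇒Mem T (a v) (tail (sp v)) (unique (sp v)) (linked (sp v)) (ends (sp v))
  from : ∀ v {w} → In v w → w ∈ a v ∷ tail (sp v)
  from v = Mem⇒∈ T (a v) (tail (sp v)) (linked (sp v)) (ends (sp v))

-- Local modifications of the host tree

-- Sliding: the edge xy is replaced by zy, where z is another neighbour of x.
module Slide {n : ℕ} (T : RTree n) {x y z : Fin n}
             (xy : RTree.E T x y) (xz : RTree.E T x z) (y≢z : y ≢ z) where
  open RTree T

  data E' : Fin n → Fin n → Set where
    old : ∀ {u w} → E u w → ¬ (u ≡ x × w ≡ y) → ¬ (u ≡ y × w ≡ x) → E' u w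
    zy  : E' z y
    yz  : E' y z

  E'-inv : ∀ {u i} → E' u i → u ≢ z →
           (E u i × ¬ (u ≡ x × i ≡ y) × ¬ (u ≡ y × i ≡ x)) ⊎ (u ≡ y × i ≡ z)
  E'-inv (old e p q) _ = inj₁ (e , p , q)
  E'-inv zy z≢z = ⊥-elim (z≢z refl)
  E'-inv yz _ = inj₂ (refl , refl)

  x≢y = E-irr xy
  x≢z = E-irr xz

  -- The nodes beyond `y` are those with `hop x c ≡ y`. For `z` the test is made in the row of `x`,
  -- because the old row of `z` sends everything on the side of `x` to `x`.
  hopBy : ∀ {w} → Dec (w ≡ x) → Dec (w ≡ y) → Dec (w ≡ z) → Fin n → Fin n
  hopBy (yes _) _ _ c = if does (hop x c ≟ y) then z else hop x c
  hopBy (no _) (yes _) _ c = if does (hop y c ≟ x) then z else hop y c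
  hopBy (no _) (no _) (yes _) c = if does (hop x c ≟ y) then y else hop z c
  hopBy {w} (no _) (no _) (no _) c = hop w c

  hop' : Fin n → Fin n → Fin n
  hop' w c = hopBy (w ≟ x) (w ≟ y) (w ≟ z) c

  x-hit : ∀ {c} → hop x c ≡ y → hop' x c ≡ z
  x-hit {c} e with x ≟ x
  ... | no ne = ⊥-elim (ne refl)
  ... | yes _ rewrite dec-true (hop x c ≟ y) e = refl

  x-miss : ∀ {c} → hop x c ≢ y → hop' x c ≡ hop x c
  x-miss {c} e with x ≟ x
  ... | no ne = ⊥-elim (ne refl)
  ... | yes _ rewrite dec-false (hop x c ≟ y) e = refl

  y-hit : ∀ {c} → hop y c ≡ x → hop' y c ≡ z
  y-hit {c} e with y ≟ x | y ≟ y
  ... | yes h | _ = ⊥-elim (x≢y (sym h))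
  ... | no _ | no ne = ⊥-elim (ne refl)
  ... | no _ | yes _ rewrite dec-true (hop y c ≟ x) e = refl

  y-miss : ∀ {c} → hop y c ≢ x → hop' y c ≡ hop y c
  y-miss {c} e with y ≟ x | y ≟ y
  ... | yes h | _ = ⊥-elim (x≢y (sym h))
  ... | no _ | no ne = ⊥-elim (ne refl)
  ... | no _ | yes _ rewrite dec-false (hop y c ≟ x) e = refl

  z-hit : ∀ {c} → hop x c ≡ y → hop' z c ≡ y
  z-hit {c} e with z ≟ x | z ≟ y | z ≟ z
  ... | yes h | _ | _ = ⊥-elim (x≢z (sym h))
  ... | no _ | yes h | _ = ⊥-elim (y≢z (sym h))
  ... | no _ | no _ | no ne = ⊥-elim (ne refl)
  ... | no _ | no _ | yes _ rewrite dec-true (hop x c ≟ y) e = refl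

  z-miss : ∀ {c} → hop x c ≢ y → hop' z c ≡ hop z c
  z-miss {c} e with z ≟ x | z ≟ y | z ≟ z
  ... | yes h | _ | _ = ⊥-elim (x≢z (sym h))
  ... | no _ | yes h | _ = ⊥-elim (y≢z (sym h))
  ... | no _ | no _ | no ne = ⊥-elim (ne refl)
  ... | no _ | no _ | yes _ rewrite dec-false (hop x c ≟ y) e = refl

  other : ∀ {w c} → w ≢ x → w ≢ y → w ≢ z → hop' w c ≡ hop w c
  other {w} w≢x w≢y w≢z with w ≟ x | w ≟ y | w ≟ z
  ... | yes h | _ | _ = ⊥-elim (w≢x h)
  ... | no _ | yes h | _ = ⊥-elim (w≢y h)
  ... | no _ | no _ | yes h = ⊥-elim (w≢z h)
  ... | no _ | no _ | no _ = refl

  x-cong : ∀ {c d} → hop x c ≡ hop x d → hop' x c ≡ hop' x d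
  x-cong {c} {d} e with hop x c ≟ y
  ... | yes h = trans (x-hit h) (sym (x-hit (trans (sym e) h)))
  ... | no h  = trans (x-miss h) (trans e (sym (x-miss (h ∘ trans e))))

  y-cong : ∀ {c d} → hop y c ≡ hop y d → hop' y c ≡ hop' y d
  y-cong {c} {d} e with hop y c ≟ x
  ... | yes h = trans (y-hit h) (sym (y-hit (trans (sym e) h)))
  ... | no h  = trans (y-miss h) (trans e (sym (y-miss (h ∘ trans e))))

  yx : hop y x ≡ x
  yx = hop-nbr (E-sym xy)

  far : ∀ {c} → hop x c ≡ y → hop z c ≡ x
  far {c} e with hop-opposite x≢z c
  ... | inj₁ p = ⊥-elim (y≢z (trans (sym e) (trans p (hop-nbr xz))))
  ... | inj₂ p = trans p (hop-nbr (E-sym xz))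

  -- Otherwise `x`, `y`, `z` would form a triangle. Thus an entry `y` in the new row of `z` can only
  -- come from a node beyond `y`.
  hop-z≢y : ∀ {c} → hop z c ≢ y
  hop-z≢y {c} e with c ≟ z
  ... | yes refl = y≢z (trans (sym e) (hop-self z))
  ... | no c≢z = x≢y (trans (sym (far (hop-nbr xy)))
                   (hop-nbr (subst (E z) e (hop-E c≢z))))

  hop-y≢z : ∀ {c} → hop y c ≢ z
  hop-y≢z {c} e with c ≟ y
  ... | yes refl = y≢z (trans (sym (hop-self y)) e)
  ... | no c≢y = x≢z (trans (sym yx) (trans (hop-step xz x≢y (y≢z ∘ sym))
                   (hop-nbr (subst (E y) e (hop-E c≢y)))))

  Tree' : RTree n
  Tree' = record
    { E        = E'
    ; hop      = hop'
    ; E-sym    = λ { (old e p q) → old (E-sym e) (λ (a , b) → q (b , a)) (λ (a , b) → p (b , a))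
                   ; zy → yz ; yz → zy }
    ; E-irr    = λ { (old e _ _) → E-irr e ; zy → y≢z ∘ sym ; yz → y≢z }
    ; hop-self = self
    ; hop-E    = hopE
    ; hop-nbr  = nbr
    ; hop-step = stp
    ; walk     = λ u w → Star.kleisliStar id edge (walk u w)
    }
    where
    self : ∀ w → hop' w w ≡ w
    self w = by (w ≟ x) (w ≟ y) (w ≟ z)
      where
      by : Dec (w ≡ x) → Dec (w ≡ y) → Dec (w ≡ z) → hop' w w ≡ w
      by (yes refl) _ _ = trans (x-miss λ h → x≢y (trans (sym (hop-self x)) h)) (hop-self x)
      by (no _) (yes refl) _ = trans (y-miss λ h → x≢y (sym (trans (sym (hop-self y)) h))) (hop-self y)
      by (no _) (no _) (yes refl) =
        trans (z-miss λ h → y≢z (sym (trans (sym (hop-nbr xz)) h))) (hop-self z)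
      by (no p) (no q) (no r) = trans (other p q r) (hop-self w)
    hopE : ∀ {w c} → c ≢ w → E' w (hop' w c)
    hopE {w} {c} c≢w = by (w ≟ x) (w ≟ y) (w ≟ z)
      where
      by : Dec (w ≡ x) → Dec (w ≡ y) → Dec (w ≡ z) → E' w (hop' w c)
      by (yes refl) _ _ with hop x c ≟ y
      ... | yes h = subst (E' x) (sym (x-hit h)) (old xz (y≢z ∘ sym ∘ proj₂) (x≢y ∘ proj₁))
      ... | no h  = subst (E' x) (sym (x-miss h)) (old (hop-E c≢w) (h ∘ proj₂) (x≢y ∘ proj₁))
      by (no _) (yes refl) _ with hop y c ≟ x
      ... | yes h = subst (E' y) (sym (y-hit h)) yz
      ... | no h  = subst (E' y) (sym (y-miss h)) (old (hop-E c≢w) (x≢y ∘ sym ∘ proj₁) (h ∘ proj₂))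
      by (no _) (no _) (yes refl) with hop x c ≟ y
      ... | yes h = subst (E' z) (sym (z-hit h)) zy
      ... | no h  = subst (E' z) (sym (z-miss h)) (old (hop-E c≢w) (x≢z ∘ sym ∘ proj₁) (y≢z ∘ sym ∘ proj₁))
      by (no p) (no q) (no r) =
        subst (E' w) (sym (other p q r)) (old (hop-E c≢w) (p ∘ proj₁) (q ∘ proj₁))
    nbr : ∀ {w i} → E' w i → hop' w i ≡ i
    nbr zy = z-hit (hop-nbr xy)
    nbr yz = y-hit (trans (sym (hop-step xz x≢y (y≢z ∘ sym))) yx)
    nbr {w} {i} (old e p q) = by (w ≟ x) (w ≟ y) (w ≟ z)
      where
      h = hop-nbr e
      by : Dec (w ≡ x) → Dec (w ≡ y) → Dec (w ≡ z) → hop' w i ≡ i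
      by (yes refl) _ _ = trans (x-miss λ k → p (refl , trans (sym h) k)) h
      by (no _) (yes refl) _ = trans (y-miss λ k → q (refl , trans (sym h) k)) h
      by (no _) (no _) (yes refl) = trans (z-miss miss) h
        where
        miss : hop x i ≢ y
        miss k = x≢y (trans (sym (hop-self x))
          (trans (cong (hop x) (trans (sym (far k)) h)) k))
      by (no a) (no b) (no c) = trans (other a b c) h
    stp : ∀ {w c d} → E' c d → c ≢ w → d ≢ w → hop' w c ≡ hop' w d
    stp {w} {c} {d} (old e p q) c≢w d≢w = by (w ≟ x) (w ≟ y) (w ≟ z)
      where
      s = hop-step e c≢w d≢w
      hits : ∀ {c d} → E c d → ¬ (c ≡ x × d ≡ y) → hop x c ≡ y → d ≢ x → hop x d ≡ y
      hits {c} e' r h d≢x with c ≟ x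
      ... | yes refl = ⊥-elim (x≢y (trans (sym (hop-self x)) h))
      ... | no c≢x = trans (sym (hop-step e' c≢x d≢x)) h
      notx : ∀ {c d} → E c d → ¬ (c ≡ y × d ≡ x) → hop x c ≡ y → d ≢ x
      notx e' r h refl = r (trans (sym (hop-nbr (E-sym e'))) h , refl)
      by : Dec (w ≡ x) → Dec (w ≡ y) → Dec (w ≡ z) → hop' w c ≡ hop' w d
      by (yes refl) _ _ = x-cong s
      by (no _) (yes refl) _ = y-cong s
      by (no _) (no _) (yes refl) with hop x c ≟ y | hop x d ≟ y
      ... | yes h | yes k = trans (z-hit h) (sym (z-hit k))
      ... | no h | no k = trans (z-miss h) (trans s (sym (z-miss k)))
      ... | yes h | no k = ⊥-elim (k (hits e p h (notx e q h)))
      ... | no h | yes k = ⊥-elim (h (hits (E-sym e) (λ (a , b) → q (b , a)) k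
                                    (notx (E-sym e) (λ (a , b) → p (b , a)) k)))
      by (no a) (no b) (no c) = trans (other a b c) (trans s (sym (other a b c)))
    stp {w} zy z≢w y≢w = by (w ≟ x)
      where
      by : Dec (w ≡ x) → hop' w z ≡ hop' w y
      by (yes refl) = trans (x-miss (λ h → y≢z (trans (sym h) (hop-nbr xz))))
                        (trans (hop-nbr xz) (sym (x-hit (hop-nbr xy))))
      by (no w≢x) = trans (other w≢x (y≢w ∘ sym) (z≢w ∘ sym))
        (trans (trans (hop-step (E-sym xz) z≢w (w≢x ∘ sym)) (hop-step xy (w≢x ∘ sym) y≢w))
          (sym (other w≢x (y≢w ∘ sym) (z≢w ∘ sym))))
    stp yz y≢w z≢w = sym (stp zy z≢w y≢w)
    xz' : E' x z
    xz' = old xz (y≢z ∘ sym ∘ proj₂) (x≢y ∘ proj₁)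
    zx' : E' z x
    zx' = old (E-sym xz) (x≢z ∘ sym ∘ proj₁) (y≢z ∘ sym ∘ proj₁)
    edge : ∀ {u w} → E u w → Star E' u w
    edge {u} {w} e with u ≟ x | w ≟ y | u ≟ y | w ≟ x
    ... | yes refl | yes refl | _ | _ = xz' ◅ zy ◅ ε
    ... | _ | _ | yes refl | yes refl = yz ◅ zx' ◅ ε
    ... | no a | _ | no c | _ = old e (a ∘ proj₁) (c ∘ proj₁) ◅ ε
    ... | no a | _ | yes _ | no d = old e (a ∘ proj₁) (d ∘ proj₂) ◅ ε
    ... | yes _ | no b | no c | _ = old e (b ∘ proj₂) (c ∘ proj₁) ◅ ε
    ... | yes _ | no b | yes _ | no d = old e (b ∘ proj₂) (d ∘ proj₂) ◅ ε

  module T' = RTree Tree'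

  y-inj : ∀ {c d} → hop' y c ≡ hop' y d → hop y c ≡ hop y d
  y-inj {c} {d} e with hop y c ≟ x | hop y d ≟ x
  ... | yes h | yes k = trans h (sym k)
  ... | no h | no k = trans (sym (y-miss h)) (trans e (y-miss k))
  ... | yes h | no k = ⊥-elim (hop-y≢z (trans (sym (y-miss k)) (trans (sym e) (y-hit h))))
  ... | no h | yes k = ⊥-elim (hop-y≢z (trans (sym (y-miss h)) (trans e (y-hit k))))

  hop'-inj : ∀ {w c d} → w ≢ x → w ≢ z → hop' w c ≡ hop' w d → hop w c ≡ hop w d
  hop'-inj {w} {c} {d} w≢x w≢z eq = by (w ≟ y)
    where
    by : Dec (w ≡ y) → hop w c ≡ hop w d
    by (yes refl) = y-inj eq
    by (no w≢y) = trans (sym (other w≢x w≢y w≢z)) (trans eq (other w≢x w≢y w≢z))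

  hop'-cong : ∀ {w c d} → w ≢ x → w ≢ z → hop w c ≡ hop w d → hop' w c ≡ hop' w d
  hop'-cong {w} {c} {d} w≢x w≢z eq = by (w ≟ y)
    where
    by : Dec (w ≡ y) → hop' w c ≡ hop' w d
    by (yes refl) = y-cong eq
    by (no w≢y) = trans (other w≢x w≢y w≢z) (trans eq (sym (other w≢x w≢y w≢z)))

  Mem-to : ∀ {w a b} → w ≢ x → w ≢ z → Mem w a b → T'.Mem w a b
  Mem-to w≢x w≢z m eq = m (hop'-inj w≢x w≢z eq)

  Mem-from : ∀ {w a b} → w ≢ x → w ≢ z → T'.Mem w a b → Mem w a b
  Mem-from w≢x w≢z m eq = m (hop'-cong w≢x w≢z eq)

  Mem-x-from : ∀ {a b} → T'.Mem x a b → Mem x a b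
  Mem-x-from m eq = m (x-cong eq)

  -- At `x` the slide merges the branches of `y` and `z`, so `x` can be lost only by a path that
  -- leaves it by these two neighbours.
  Mem-x-to : ∀ {a b} → ¬ (hop x a ≡ y × hop x b ≡ z) → ¬ (hop x a ≡ z × hop x b ≡ y) →
             Mem x a b → T'.Mem x a b
  Mem-x-to {a} {b} p q m eq with hop x a ≟ y | hop x b ≟ y
  ... | yes h | yes k = m (trans h (sym k))
  ... | no h | no k = m (trans (sym (x-miss h)) (trans eq (x-miss k)))
  ... | yes h | no k = ⊥-elim (p (h , trans (sym (x-miss k)) (trans (sym eq) (x-hit h))))
  ... | no h | yes k = ⊥-elim (q (trans (sym (x-miss h)) (trans eq (x-hit k)) , k))

  Mem-z-to : ∀ {a b} → Mem z a b → T'.Mem z a b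
  Mem-z-to {a} {b} m eq with hop x a ≟ y | hop x b ≟ y
  ... | yes h | yes k = m (trans (far h) (sym (far k)))
  ... | no h | no k = m (trans (sym (z-miss h)) (trans eq (z-miss k)))
  ... | yes h | no k = ⊥-elim (hop-z≢y (trans (sym (z-miss k)) (trans (sym eq) (z-hit h))))
  ... | no h | yes k = ⊥-elim (hop-z≢y (trans (sym (z-miss h)) (trans eq (z-hit k))))

  -- A path gained by `z` has exactly one end beyond `y`, so it contained `x`.
  Mem-z-from : ∀ {a b} → T'.Mem z a b → Mem z a b ⊎ Mem x a b
  Mem-z-from {a} {b} m with hop x a ≟ y | hop x b ≟ y
  ... | yes h | yes k = ⊥-elim (y≢z (trans (sym h)
          (trans (cong (hop x) (m (trans (z-hit h) (sym (z-hit k))))) (hop-nbr xz))))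
  ... | no h | no k = inj₁ λ eq → m (trans (z-miss h) (trans eq (sym (z-miss k))))
  ... | yes h | no k = inj₂ λ eq → ⊥-elim (k (trans (sym eq) h))
  ... | no h | yes k = inj₂ λ eq → ⊥-elim (h (trans eq k))

  module _ {N : ℕ} {G : Graph N} (R : Rep G T) where
    open Rep R

    module _ (x⊆z : ∀ v → In v x → In v z) where

      contract-⊆ : ∀ {v q} → T'.Mem q (a v) (b v) → In v q
      contract-⊆ {v} {q} m = by (q ≟ x) (q ≟ z)
        where
        by : Dec (q ≡ x) → Dec (q ≡ z) → In v q
        by (yes refl) _ = Mem-x-from m
        by (no _) (yes refl) = [ id , x⊆z v ]′ (Mem-z-from m)
        by (no q≢x) (no q≢z) = Mem-from q≢x q≢z m

      -- x may lose paths, but all paths through x also contain z.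
      contractRep : Rep G Tree'
      contractRep = record { a = a ; b = b ; edges = λ u v u≢v → mk⇔
        (to ∘ Equivalence.to (edges u v u≢v)) (Equivalence.from (edges u v u≢v) ∘ from) }
        where
        to : ∀ {u v} → (∃ λ q → In u q × In v q) →
             ∃ λ q → T'.Mem q (a u) (b u) × T'.Mem q (a v) (b v)
        to {u} {v} (q , qu , qv) with q ≟ x | q ≟ z
        ... | yes refl | _ = z , Mem-z-to (x⊆z u qu) , Mem-z-to (x⊆z v qv)
        ... | no _ | yes refl = z , Mem-z-to qu , Mem-z-to qv
        ... | no q≢x | no q≢z = q , Mem-to q≢x q≢z qu , Mem-to q≢x q≢z qv
        from : ∀ {u v} → (∃ λ q → T'.Mem q (a u) (b u) × T'.Mem q (a v) (b v)) →
               ∃ λ q → In u q × In v q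
        from (q , qu , qv) = q , contract-⊆ qu , contract-⊆ qv

    module _ (z⊆x : ∀ v → In v z → In v x)
             (¬yz : ∀ v → ¬ (hop x (a v) ≡ y × hop x (b v) ≡ z))
             (¬zy : ∀ v → ¬ (hop x (a v) ≡ z × hop x (b v) ≡ y)) where

      -- No path loses `x`, since none leaves it by both `y` and `z`. Every path that now contains
      -- `z` contained `x` before, so a meeting at `z` is no new adjacency.
      splitRep : Rep G Tree'
      splitRep = record { a = a ; b = b ; edges = λ u v u≢v → mk⇔
        (to ∘ Equivalence.to (edges u v u≢v)) (Equivalence.from (edges u v u≢v) ∘ from) }
        where
        to : ∀ {u v} → (∃ λ q → In u q × In v q) →
             ∃ λ q → T'.Mem q (a u) (b u) × T'.Mem q (a v) (b v)
        to {u} {v} (q , qu , qv) with q ≟ x | q ≟ z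
        ... | yes refl | _ = x , Mem-x-to (¬yz u) (¬zy u) qu , Mem-x-to (¬yz v) (¬zy v) qv
        ... | no _ | yes refl = z , Mem-z-to qu , Mem-z-to qv
        ... | no q≢x | no q≢z = q , Mem-to q≢x q≢z qu , Mem-to q≢x q≢z qv
        from : ∀ {u v} → (∃ λ q → T'.Mem q (a u) (b u) × T'.Mem q (a v) (b v)) →
               ∃ λ q → In u q × In v q
        from {u} {v} (q , qu , qv) = by (q ≟ x) (q ≟ z)
          where
          by : Dec (q ≡ x) → Dec (q ≡ z) → ∃ λ q → In u q × In v q
          by (yes refl) _ = x , Mem-x-from qu , Mem-x-from qv
          by (no _) (yes refl) = x , [ z⊆x u , id ]′ (Mem-z-from qu) , [ z⊆x v , id ]′ (Mem-z-from qv)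
          by (no q≢x) (no q≢z) = q , Mem-from q≢x q≢z qu , Mem-from q≢x q≢z qv

      -- Restores the hypothesis `z⊆x` after the slide, so that a second neighbour can be slid to
      -- the same `z`.
      splitRep-z⊆x : ∀ v → Rep.In splitRep v z → Rep.In splitRep v x
      splitRep-z⊆x v m = Mem-x-to (¬yz v) (¬zy v) ([ z⊆x v , id ]′ (Mem-z-from m))

-- A new leaf zero hanging from x; the old nodes are shifted by suc.
module Leaf {n : ℕ} (T : RTree n) (x : Fin n) where
  open RTree T

  data E' : Fin (suc n) → Fin (suc n) → Set where
    old : ∀ {u w} → E u w → E' (suc u) (suc w)
    lx  : E' zero (suc x)
    xl  : E' (suc x) zero

  hop' : Fin (suc n) → Fin (suc n) → Fin (suc n)
  hop' zero zero = zero
  hop' zero (suc _) = suc x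
  hop' (suc w) (suc c) = suc (hop w c)
  hop' (suc w) zero with w ≟ x
  ... | yes _ = zero
  ... | no _  = suc (hop w x)

  x-leaf : hop' (suc x) zero ≡ zero
  x-leaf with x ≟ x
  ... | yes _ = refl
  ... | no ne = ⊥-elim (ne refl)

  toLeaf : ∀ {w} → w ≢ x → hop' (suc w) zero ≡ suc (hop w x)
  toLeaf {w} w≢x with w ≟ x
  ... | yes p = ⊥-elim (w≢x p)
  ... | no _ = refl

  Tree' : RTree (suc n)
  Tree' = record
    { E        = E'
    ; hop      = hop'
    ; E-sym    = λ { (old e) → old (E-sym e) ; lx → xl ; xl → lx }
    ; E-irr    = λ { (old e) → E-irr e ∘ suc-injective ; lx () ; xl () }
    ; hop-self = λ { zero → refl ; (suc w) → cong suc (hop-self w) }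
    ; hop-E    = hopE
    ; hop-nbr  = λ { (old e) → cong suc (hop-nbr e) ; lx → refl ; xl → x-leaf }
    ; hop-step = stp
    ; walk     = wlk
    }
    where
    hopE : ∀ {w c} → c ≢ w → E' w (hop' w c)
    hopE {zero} {zero} ne = ⊥-elim (ne refl)
    hopE {zero} {suc c} _ = lx
    hopE {suc w} {suc c} ne = old (hop-E (ne ∘ cong suc))
    hopE {suc w} {zero} _ with w ≟ x
    ... | yes refl = xl
    ... | no w≢x = old (hop-E (w≢x ∘ sym))
    stp : ∀ {w c d} → E' c d → c ≢ w → d ≢ w → hop' w c ≡ hop' w d
    stp {zero} (old e) _ _ = refl
    stp {suc w} (old e) p q = cong suc (hop-step e (p ∘ cong suc) (q ∘ cong suc))
    stp {zero} lx p _ = ⊥-elim (p refl)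
    stp {suc w} lx _ q = toLeaf λ { refl → q refl }
    stp {zero} xl _ q = ⊥-elim (q refl)
    stp {suc w} xl p _ = sym (toLeaf λ { refl → p refl })
    wlk : ∀ u w → Star E' u w
    wlk zero zero = ε
    wlk zero (suc w) = lx ◅ Star.gmap suc old (walk x w)
    wlk (suc u) zero = Star.gmap suc old (walk u x) ◅◅ xl ◅ ε
    wlk (suc u) (suc w) = Star.gmap suc old (walk u w)

  module _ {N : ℕ} {G : Graph N} (R : Rep G T) where
    open Rep R

    leafRep : Rep G Tree'
    leafRep = record { a = suc ∘ a ; b = suc ∘ b ; edges = λ u v u≢v → mk⇔
      (to ∘ Equivalence.to (edges u v u≢v)) (Equivalence.from (edges u v u≢v) ∘ from) }
      where
      module T' = RTree Tree'
      to : ∀ {u v} → (∃ λ q → In u q × In v q) →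
           ∃ λ q → T'.Mem q (suc (a u)) (suc (b u)) × T'.Mem q (suc (a v)) (suc (b v))
      to (q , qu , qv) = suc q , cong suc ∘ qu ∘ suc-injective , cong suc ∘ qv ∘ suc-injective
      from : ∀ {u v} →
             (∃ λ q → T'.Mem q (suc (a u)) (suc (b u)) × T'.Mem q (suc (a v)) (suc (b v))) →
             ∃ λ q → In u q × In v q
      from (zero , qu , _) with qu refl
      ... | ()
      from (suc q , qu , qv) = q , suc-injective ∘ qu ∘ cong suc , suc-injective ∘ qv ∘ cong suc

    leaf-empty : ∀ v → ¬ Rep.In leafRep v zero
    leaf-empty v m with m refl
    ... | ()

-- Representations of minimal total path length

module _ {A : Set} {P Q : A → Set} (P? : Decidable P) (Q? : Decidable Q)
         (P⊆Q : ∀ {x} → P x → Q x) where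

  length-filter-mono : ∀ xs → length (filter P? xs) ≤ length (filter Q? xs)
  length-filter-mono [] = z≤n
  length-filter-mono (x ∷ xs) with P? x | Q? x
  ... | yes _ | yes _ = s≤s (length-filter-mono xs)
  ... | yes p | no ¬q = ⊥-elim (¬q (P⊆Q p))
  ... | no _  | yes _ = m≤n⇒m≤1+n (length-filter-mono xs)
  ... | no _  | no _  = length-filter-mono xs

  length-filter-< : ∀ {xs} → Any (λ x → Q x × ¬ P x) xs →
                    length (filter P? xs) < length (filter Q? xs)
  length-filter-< {x ∷ xs} (here (q , ¬p)) with P? x | Q? x
  ... | yes p | _ = ⊥-elim (¬p p)
  ... | no _ | no ¬q = ⊥-elim (¬q q)
  ... | no _ | yes _ = s≤s (length-filter-mono xs)
  length-filter-< {x ∷ xs} (there i) with P? x | Q? x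
  ... | yes _ | yes _ = s≤s (length-filter-< i)
  ... | yes p | no ¬q = ⊥-elim (¬q (P⊆Q p))
  ... | no _  | yes _ = m≤n⇒m≤1+n (length-filter-< i)
  ... | no _  | no _  = length-filter-< i

module _ {N : ℕ} {G : Graph N} {n : ℕ} where

  -- Slides keep the node set, so contracting is seen in this count and not in the size of the tree.
  totalLength : {T : RTree n} → Rep G T → ℕ
  totalLength R = length (filter (λ (v , w) → Rep.In? R v w) (cartesianProduct (allFin N) (allFin n)))

  totalLength-< : {T T' : RTree n} (R : Rep G T) (R' : Rep G T') →
    (∀ {v w} → Rep.In R' v w → Rep.In R v w) →
    ∀ {v w} → Rep.In R v w → ¬ Rep.In R' v w → totalLength R' < totalLength R
  totalLength-< R R' sub {v} {w} p q =
    length-filter-< (λ (v , w) → Rep.In? R' v w) (λ (v , w) → Rep.In? R v w) sub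
      (lose (∈-cartesianProduct⁺ (∈-allFin v) (∈-allFin w)) (p , q))

  Normal : {T : RTree n} → Rep G T → Set
  Normal {T} R = ∀ {x z} → RTree.E T x z → ∀ {c} → Rep.In R c x → ∃ λ u → Rep.In R u x × ¬ Rep.In R u z

  module Shorten {T : RTree n} (R : Rep G T) {x z} (xz : RTree.E T x z)
                 (x⊆z : ∀ v → Rep.In R v x → Rep.In R v z) where
    open RTree T
    open Rep R

    x≢z = E-irr xz

    -- All path ends at `x` are withdrawn to `z` at once. A path loses at most `x`, and by `x⊆z`
    -- paths that met at `x` still meet at `z`.
    move : Fin n → Fin n
    move t = if does (t ≟ x) then z else t

    move-x : move x ≡ z
    move-x with x ≟ x
    ... | yes _ = refl
    ... | no ne = ⊥-elim (ne refl)

    move-≢ : ∀ {t} → t ≢ x → move t ≡ t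
    move-≢ {t} ne with t ≟ x
    ... | yes e = ⊥-elim (ne e)
    ... | no _ = refl

    In' : Fin N → Fin n → Set
    In' v w = Mem w (move (a v)) (move (b v))

    hop-move : ∀ {w t} → w ≢ x → w ≢ z → hop w (move t) ≡ hop w t
    hop-move {w} {t} w≢x w≢z with t ≟ x
    ... | yes refl = hop-step (E-sym xz) (w≢z ∘ sym) (w≢x ∘ sym)
    ... | no _ = refl

    move-inj : ∀ {w t} → w ≢ x → w ≢ z → move t ≡ w → t ≡ w
    move-inj {w} {t} w≢x w≢z e with t ≟ x
    ... | yes _ = ⊥-elim (w≢z (sym e))
    ... | no _ = e

    end-a : ∀ {v} → a v ≡ x → In v x
    end-a e _ = e

    end-b : ∀ {v} → b v ≡ x → In v x
    end-b e = Mem-sym λ _ → e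

    shorten-⊆ : ∀ {v w} → In' v w → In v w
    shorten-⊆ {v} {w} m = by (w ≟ x) (w ≟ z) (a v ≟ x) (b v ≟ x)
      where
      by : Dec (w ≡ x) → Dec (w ≡ z) → Dec (a v ≡ x) → Dec (b v ≡ x) → In v w
      by (yes refl) _ (yes p) _ = end-a p
      by (yes refl) _ _ (yes p) = end-b p
      by _ (yes refl) (yes p) _ = x⊆z v (end-a p)
      by _ (yes refl) _ (yes p) = x⊆z v (end-b p)
      by (no w≢x) (no w≢z) _ _ eq =
        move-inj w≢x w≢z (m (trans (hop-move w≢x w≢z) (trans eq (sym (hop-move w≢x w≢z)))))
      by _ _ (no p) (no q) = subst₂ (Mem w) (move-≢ p) (move-≢ q) m

    shorten-⊇ : ∀ {v w} → w ≢ x → In v w → In' v w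
    shorten-⊇ {v} {w} w≢x m = by (w ≟ z) (a v ≟ x) (b v ≟ x)
      where
      by : Dec (w ≡ z) → Dec (a v ≡ x) → Dec (b v ≡ x) → In' v w
      by (no w≢z) _ _ eq =
        trans (cong move (m (trans (sym (hop-move w≢x w≢z)) (trans eq (hop-move w≢x w≢z))))) (move-≢ w≢x)
      by (yes refl) (yes p) _ _ = trans (cong move p) move-x
      by (yes refl) _ (yes p) = Mem-sym λ _ → trans (cong move p) move-x
      by _ (no p) (no q) = subst₂ (Mem w) (sym (move-≢ p)) (sym (move-≢ q)) m

    shortenRep : Rep G T
    shortenRep = record { a = move ∘ a ; b = move ∘ b ; edges = λ u v u≢v → mk⇔
      (to ∘ Equivalence.to (edges u v u≢v)) (Equivalence.from (edges u v u≢v) ∘ from) }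
      where
      to : ∀ {u v} → (∃ λ q → In u q × In v q) → ∃ λ q → In' u q × In' v q
      to {u} {v} (q , qu , qv) with q ≟ x
      ... | yes refl = z , shorten-⊇ (x≢z ∘ sym) (x⊆z u qu) , shorten-⊇ (x≢z ∘ sym) (x⊆z v qv)
      ... | no q≢x = q , shorten-⊇ q≢x qu , shorten-⊇ q≢x qv
      from : ∀ {u v} → (∃ λ q → In' u q × In' v q) → ∃ λ q → In u q × In v q
      from (q , qu , qv) = q , shorten-⊆ qu , shorten-⊆ qv

    private
      lost : ∀ {s t} → s ≡ x → Mem z s t → ¬ Mem x (move s) (move t)
      lost {s} {t} refl m m' = x≢z (sym (trans (sym move-x) (m' (trans (cong (hop x) move-x)
                                 (trans (hop-nbr xz) (sym far))))))
        where
        far : hop x (move t) ≡ z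
        far with t ≟ x
        ... | yes refl = ⊥-elim (x≢z (m refl))
        ... | no _ with hop-opposite x≢z t
        ...   | inj₁ e = trans e (hop-nbr xz)
        ...   | inj₂ e = ⊥-elim (x≢z (m (sym e)))

    shorten-a : ∀ {c} → a c ≡ x → ¬ In' c x
    shorten-a {c} e = lost e (x⊆z c (end-a e))

    shorten-b : ∀ {c} → b c ≡ x → ¬ In' c x
    shorten-b {c} e m = lost e (Mem-sym (x⊆z c (end-b e))) (Mem-sym m)

  module _ {T : RTree n} (R : Rep G T) {x z c} (xz : RTree.E T x z) (cx : Rep.In R c x)
           (x⊆z : ∀ v → Rep.In R v x → Rep.In R v z) where
    open RTree T
    open Rep R

    -- If `c` ends at `x`, the ends at `x` are withdrawn. Otherwise `c` leaves `x` by `z` and by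
    -- another neighbour, and sliding that neighbour to `z` takes `x` off `c`. In both cases no path
    -- gains a node.
    shrink : Σ (RTree n) λ T' → Σ (Rep G T') λ R' → totalLength R' < totalLength R
    shrink with a c ≟ x | b c ≟ x
    ... | yes p | _ = T , shortenRep , totalLength-< R shortenRep shorten-⊆ cx (shorten-a p)
      where open Shorten R xz x⊆z
    ... | _ | yes p = T , shortenRep , totalLength-< R shortenRep shorten-⊆ cx (shorten-b p)
      where open Shorten R xz x⊆z
    ... | no p | no q with hop-of-Mem {g = x} (x⊆z c cx) (λ z≡x → E-irr xz (sym z≡x))
    ...   | inj₁ e = Tree' , contractRep R x⊆z ,
            totalLength-< R (contractRep R x⊆z) (contract-⊆ R x⊆z) cx
              λ m → p (m (trans (x-miss xa≢) (trans xa (sym (x-hit refl)))))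
      where
      xa : hop x (a c) ≡ z
      xa = trans (sym e) (hop-nbr xz)
      b≢z : hop x (b c) ≢ z
      b≢z h = p (cx (trans xa (sym h)))
      open Slide T (hop-E q) xz b≢z
      xa≢ : hop x (a c) ≢ hop x (b c)
      xa≢ h = b≢z (trans (sym h) xa)
    ...   | inj₂ e = Tree' , contractRep R x⊆z ,
            totalLength-< R (contractRep R x⊆z) (contract-⊆ R x⊆z) cx
              λ m → p (m (trans (x-hit refl) (sym (trans (x-miss xb≢) xb))))
      where
      xb : hop x (b c) ≡ z
      xb = trans (sym e) (hop-nbr xz)
      a≢z : hop x (a c) ≢ z
      a≢z h = p (cx (trans h (sym xb)))
      open Slide T (hop-E p) xz a≢z
      xb≢ : hop x (b c) ≢ hop x (a c)
      xb≢ h = a≢z (trans (sym h) xb)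

  normalise : {T : RTree n} → Rep G T → Σ (RTree n) λ T' → Σ (Rep G T') Normal
  normalise R = go _ R ≤-refl
    where
    go : ∀ m {T : RTree n} (R : Rep G T) → totalLength R ≤ m → Σ (RTree n) λ T' → Σ (Rep G T') Normal
    go m {T} R len with any? (λ x → any? λ z → E? T x z ×-dec any? (λ c → Rep.In? R c x)
                          ×-dec all? λ u → Rep.In? R u x →-dec Rep.In? R u z)
    ... | no ¬red = T , R , normal
      where
      normal : Normal R
      normal {x} {z} xz {c} cx
        with ¬∀⟶∃¬ N _ (λ u → Rep.In? R u x →-dec Rep.In? R u z) (λ sub → ¬red (x , z , xz , (c , cx) , sub))
      ... | u , ¬sub with Rep.In? R u x
      ...   | yes ux = u , ux , λ uz → ¬sub λ _ → uz
      ...   | no ¬ux = ⊥-elim (¬sub λ ux → ⊥-elim (¬ux ux))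
    go zero R len | yes (x , z , xz , (c , cx) , sub) with shrink R xz cx sub
    ... | _ , _ , lt = ⊥-elim (n≮0 (≤-trans lt len))
    go (suc m) R len | yes (x , z , xz , (c , cx) , sub) with shrink R xz cx sub
    ... | _ , R' , lt = go m R' (s≤s⁻¹ (≤-trans lt len))

-- Colouring the conflicts at a node

-- A vertex i pending at j has j as its only neighbour in the conflict graph, so i can be
-- recoloured after j; two vertices pending at each other form an isolated edge.
module Recolour {n h : ℕ} (Conf Pend : Fin n → Fin n → Set) (Pend? : ∀ i j → Dec (Pend i j))
  (conf-irr : ∀ {i j} → Conf i j → i ≢ j)
  (conf-sym : ∀ {i j} → Conf i j → Conf j i)
  (pend-only : ∀ {i j k} → Pend i j → Conf i k → k ≡ j)
  (g : Fin n → Fin (suc (suc h)))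
  (g-proper : ∀ {i j} → Conf i j → g i ≡ g j → Pend i j ⊎ Pend j i) where

  C = Fin (suc (suc h))

  avoiding : C → C
  avoiding zero = suc zero
  avoiding (suc _) = zero

  avoiding-≢ : ∀ c → avoiding c ≢ c
  avoiding-≢ zero ()
  avoiding-≢ (suc _) ()

  -- Breaks the symmetry between two vertices that are pending at each other.
  order : Fin n → Fin n → C
  order i j with i Fin.<? j
  ... | yes _ = zero
  ... | no _ = suc zero

  order-≢ : ∀ {i j} → i ≢ j → order i j ≢ order j i
  order-≢ {i} {j} i≢j with i Fin.<? j | j Fin.<? i
  ... | yes p | yes q = λ _ → <-asym p q
  ... | yes _ | no _ = λ ()
  ... | no _ | yes _ = λ ()
  ... | no p | no q = λ _ → i≢j (≤-antisym (≮⇒≥ q) (≮⇒≥ p))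

  -- A relation, so that `clash` can match on the cases without evaluating the searches in `spec`.
  Spec : Fin n → C → Set
  Spec i κ = (¬ ∃ (Pend i) × κ ≡ g i)
    ⊎ (∃ λ j → Pend i j × ((∃ (Pend j) × κ ≡ order i j) ⊎ (¬ ∃ (Pend j) × κ ≡ avoiding (g j))))

  spec : ∀ i → ∃ (Spec i)
  spec i with any? (Pend? i)
  ... | no ¬p = g i , inj₁ (¬p , refl)
  ... | yes (j , p) with any? (Pend? j)
  ...   | yes q = order i j , inj₂ (j , p , inj₁ (q , refl))
  ...   | no ¬q = avoiding (g j) , inj₂ (j , p , inj₂ (¬q , refl))

  recolour : Fin n → C
  recolour i = proj₁ (spec i)

  -- If neither end is pending, `g-proper` applies. By `pend-only` a pending end is pending at the
  -- other end, so either its new colour avoids the colour kept there, or both are pending at each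
  -- other and `order` separates them.
  clash : ∀ {i k κ} → Conf i k → Spec i κ → Spec k κ → ⊥
  clash c (inj₁ (¬p , refl)) (inj₁ (¬q , e)) = [ (λ p → ¬p (_ , p)) , (λ q → ¬q (_ , q)) ]′ (g-proper c e)
  clash c (inj₁ (¬p , refl)) (inj₂ (j , q , s)) with pend-only q (conf-sym c)
  clash c (inj₁ (¬p , refl)) (inj₂ (j , q , inj₁ (p , _))) | refl = ¬p p
  clash c (inj₁ (¬p , refl)) (inj₂ (j , q , inj₂ (_ , e))) | refl = avoiding-≢ _ (sym e)
  clash c (inj₂ (j , p , s)) sk with pend-only p c
  clash c (inj₂ (j , p , inj₁ (q , _))) (inj₁ (¬q , _)) | refl = ¬q q
  clash c (inj₂ (j , p , inj₂ (_ , e))) (inj₁ (_ , e')) | refl = avoiding-≢ _ (trans (sym e) e')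
  clash c (inj₂ (j , p , s)) (inj₂ (l , q , s')) | refl with pend-only q (conf-sym c)
  clash c (inj₂ (j , p , inj₁ (_ , e))) (inj₂ (l , q , inj₁ (_ , e'))) | refl | refl =
    order-≢ (conf-irr c) (trans (sym e) e')
  clash c (inj₂ (j , p , inj₂ (¬q , _))) (inj₂ (l , q , _)) | refl | refl = ¬q (_ , q)
  clash c (inj₂ (j , p , inj₁ _)) (inj₂ (l , q , inj₂ (¬p , _))) | refl | refl = ¬p (_ , p)

  recolour-proper : ∀ {i k} → Conf i k → recolour i ≢ recolour k
  recolour-proper {i} {k} c e = clash c (proj₂ (spec i)) (subst (Spec k) (sym e) (proj₂ (spec k)))

-- A degree bound as a numbering injective on the neighbours of `y`. The bound is `suc h`, so other
-- nodes have a default value.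
Encoding : ℕ → ∀ {n} → RTree n → Fin n → Set
Encoding h {n} T y = Σ (Fin n → Fin (suc h)) λ enc →
  ∀ {i j} → RTree.E T y i → RTree.E T y j → enc i ≡ enc j → i ≡ j

degree-encoding : ∀ {h} (T : Tree) y → degree (Tree.adj T) y ≤ suc h →
                  Encoding h (FromTree.toRTree T) y
degree-encoding {h} T y deg = enc , injective
  where
  m = Tree.size T
  g = Tree.adj T
  L = filterᵇ (g y) (allFin m)
  enc : Fin m → Fin (suc h)
  enc i with _∈?_ _≟_ i L
  ... | yes p = inject≤ (index p) deg
  ... | no _ = zero
  ∈L : ∀ {i} → Adj g y i → i ∈ L
  ∈L {i} e = ∈-filter⁺ (T? ∘ g y) (∈-allFin i) (Equivalence.from T-≡ e)
  injective : ∀ {i j} → Adj g y i → Adj g y j → enc i ≡ enc j → i ≡ j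
  injective {i} {j} ei ej eq with _∈?_ _≟_ i L | _∈?_ _≟_ j L
  ... | no ¬p | _ = ⊥-elim (¬p (∈L ei))
  ... | _ | no ¬p = ⊥-elim (¬p (∈L ej))
  ... | yes p | yes q = trans (lookup-index p)
    (trans (cong (lookup L) (inject≤-injective deg deg _ _ eq)) (sym (lookup-index q)))

module _ {n : ℕ} (T : RTree n) where
  open RTree T

  -- A path through x meeting both P(au,bu) and P(aw,bw) enters them at their gates, and the gate
  -- nearer to x lies on every path from x to the other one.
  gates-nested : ∀ {x au bu aw bw ac bc} →
    ¬ Mem x au bu → ¬ Mem x aw bw → hop x au ≡ hop x aw →
    Mem x ac bc →
    (∃ λ q → Mem q ac bc × Mem q au bu) → (∃ λ q → Mem q ac bc × Mem q aw bw) →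
    (∀ {a b} → Mem x a b → (∃ λ q → Mem q a b × Mem q aw bw) → ∃ λ q → Mem q a b × Mem q au bu)
    ⊎ (∀ {a b} → Mem x a b → (∃ λ q → Mem q a b × Mem q au bu) → ∃ λ q → Mem q a b × Mem q aw bw)
  gates-nested {x} {au} {bu} {aw} {bw} xu xw same xc (q , qc , qu) (r , rc , rw)
    with median x au bu | median x aw bw
  ... | gu , gu∈ , gua , gub | gw , gw∈ , gwa , gwb
    with Mem-collinear xc (Mem-convex (Mem-gate gua gub qu) xc qc) (Mem-convex (Mem-gate gwa gwb rw) xc rc)
  -- `x` cannot lie between the two gates, because by `same` both are in one branch at `x`.
  ... | inj₁ m = ⊥-elim (xu (subst (λ s → Mem s au bu) (m (trans (towards xu gu∈) (trans same (sym (towards xw gw∈))))) gu∈))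
    where
    towards : ∀ {g a b} → ¬ Mem x a b → Mem g a b → hop x g ≡ hop x a
    towards ¬m g∈ with hop-of-Mem g∈ (λ { refl → ¬m g∈ })
    ... | inj₁ e = e
    ... | inj₂ e = trans e (sym (proj₁ (¬Mem⇒ ¬m)))
  ... | inj₂ (inj₁ m) = inj₁ λ xab (s , s∈ , sw) →
          gu , Mem-convex m xab (Mem-convex (Mem-gate gwa gwb sw) xab s∈) , gu∈
  ... | inj₂ (inj₂ m) = inj₂ λ xab (s , s∈ , su) →
          gw , Mem-convex m xab (Mem-convex (Mem-gate gua gub su) xab s∈) , gw∈

-- Proper colourings from vertex-deleted subgraphs.

module _ {N : ℕ} {G : Graph N} {n : ℕ} {T : RTree n} (R : Rep G T) where
  open RTree T
  open Rep R

  Meets : Fin N → Fin N → Set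
  Meets u v = ∃ λ q → In u q × In v q

  -- The three inequalities say that `x` is an inner node of the path of `v`.
  record Proper {C : Set} (x : Fin n) (col : Fin n → C) : Set where
    constructor proper
    field
      differ : ∀ v → hop x (a v) ≢ hop x (b v) → hop x (a v) ≢ x → hop x (b v) ≢ x →
               col (hop x (a v)) ≢ col (hop x (b v))

module Colour (h : ℕ) {k : ℕ} {G : Graph (suc k)} {n : ℕ} {T : RTree n} (R : Rep G T) (normal : Normal R)
              (x : Fin n) where
  open RTree T
  open Rep R

  Dir : Fin (suc k) → Fin n → Set
  Dir v i = In v x × (hop x (a v) ≡ i ⊎ hop x (b v) ≡ i)

  Dir? : ∀ v i → Dec (Dir v i)
  Dir? v i = In? v x ×-dec ((hop x (a v) ≟ i) ⊎-dec (hop x (b v) ≟ i))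

  Conf : Fin n → Fin n → Set
  Conf i j = i ≢ j × E x i × E x j × ∃ λ c → Dir c i × Dir c j

  Pend : Fin n → Fin n → Set
  Pend i j = Conf i j × (∀ c → Dir c i → Dir c j)

  Pend? : ∀ i j → Dec (Pend i j)
  Pend? i j = (¬? (i ≟ j) ×-dec E? T x i ×-dec E? T x j ×-dec any? λ c → Dir? c i ×-dec Dir? c j)
              ×-dec all? λ c → Dir? c i →-dec Dir? c j

  conf-sym : ∀ {i j} → Conf i j → Conf j i
  conf-sym (i≢j , xi , xj , c , ci , cj) = i≢j ∘ sym , xj , xi , c , cj , ci

  -- A path has at most two directions at `x`. One that witnesses the conflict of `i` and `l` also
  -- has direction `j`, so `l` is `j`.
  pend-only : ∀ {i j l} → Pend i j → Conf i l → l ≡ j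
  pend-only ((i≢j , _) , i⊆j) (i≢l , _ , _ , c , ci , cl) with ci | cl | i⊆j c ci
  ... | _ , inj₁ p | _ , inj₁ q | _ = ⊥-elim (i≢l (trans (sym p) q))
  ... | _ , inj₂ p | _ , inj₂ q | _ = ⊥-elim (i≢l (trans (sym p) q))
  ... | _ , inj₁ p | _ , inj₂ _ | _ , inj₁ r = ⊥-elim (i≢j (trans (sym p) r))
  ... | _ , inj₂ p | _ , inj₁ _ | _ , inj₂ r = ⊥-elim (i≢j (trans (sym p) r))
  ... | _ , inj₁ _ | _ , inj₂ q | _ , inj₂ r = trans (sym q) r
  ... | _ , inj₂ _ | _ , inj₁ q | _ , inj₁ r = trans (sym q) r

  Dir⇒In : ∀ {c i} → E x i → Dir c i → In c i
  Dir⇒In {c} xi (m , inj₁ refl) = Mem-hop m λ e → E-irr xi (sym (trans (cong (hop x) e) (hop-self x)))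
  Dir⇒In {c} xi (m , inj₂ refl) =
    Mem-sym (Mem-hop (Mem-sym m) λ e → E-irr xi (sym (trans (cong (hop x) e) (hop-self x))))

  branch : ∀ {u i} → E x i → In u i → ¬ In u x → ∀ {q} → In u q → hop x q ≡ i
  branch {u} {i} xi ui ¬ux uq = trans (toa uq) (trans (sym (toa ui)) (hop-nbr xi))
    where
    toa : ∀ {q} → In u q → hop x q ≡ hop x (a u)
    toa uq with hop-of-Mem uq (λ { refl → ¬ux uq })
    ... | inj₁ e = e
    ... | inj₂ e = trans e (sym (proj₁ (¬Mem⇒ ¬ux)))

  Meets⇒Dir : ∀ {u c i} → E x i → In u i → ¬ In u x → In c x → Meets R c u → Dir c i
  Meets⇒Dir xi ui ¬ux cx (q , cq , uq) with hop-of-Mem cq (λ { refl → ¬ux uq })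
  ... | inj₁ e = cx , inj₁ (trans (sym e) (branch xi ui ¬ux uq))
  ... | inj₂ e = cx , inj₂ (trans (sym e) (branch xi ui ¬ux uq))

  conflict : ∀ v → hop x (a v) ≢ hop x (b v) → hop x (a v) ≢ x → hop x (b v) ≢ x →
             Conf (hop x (a v)) (hop x (b v))
  conflict v ab ax bx = ab , nbr ax , nbr bx , v , (m , inj₁ refl) , (m , inj₂ refl)
    where
    nbr : ∀ {c} → hop x c ≢ x → E x (hop x c)
    nbr ne = hop-E λ { refl → ne (hop-self x) }
    m : In v x
    m eq = ⊥-elim (ab eq)

  module Deleted (v₀ : Fin (suc k)) (¬v₀x : ¬ In v₀ x) (c₀ : Fin (suc k)) (c₀x : In c₀ x)
                 {m : ℕ} (T' : RTree m) (R' : Rep (delete G v₀) T')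
                 (encoding : ∀ y → Encoding h T' y) where

    private
      module T' = RTree T'
      module R' = Rep R'

    ι : Fin k → Fin (suc k)
    ι = punchIn v₀

    lift : ∀ {u} → v₀ ≢ u → ∃ λ u' → ι u' ≡ u
    lift ne = punchOut ne , punchIn-punchOut ne

    liftC : ∀ {c} → In c x → ∃ λ c' → ι c' ≡ c
    liftC cx = lift λ { refl → ¬v₀x cx }

    -- Meeting means being adjacent or equal, so it carries over between representations.
    meets : ∀ {u v} → Meets R (ι u) (ι v) → Meets R' u v
    meets {u} {v} m with u ≟ v
    ... | yes refl = R'.a u , (λ _ → refl) , (λ _ → refl)
    ... | no u≢v = Equivalence.to (R'.edges u v u≢v)
                     (Equivalence.from (edges _ _ (u≢v ∘ punchIn-injective v₀ u v)) m)

    meets⁻ : ∀ {u v} → Meets R' u v → Meets R (ι u) (ι v)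
    meets⁻ {u} {v} m with u ≟ v
    ... | yes refl = a (ι u) , (λ _ → refl) , (λ _ → refl)
    ... | no u≢v = Equivalence.to (edges _ _ (u≢v ∘ punchIn-injective v₀ u v))
                     (Equivalence.from (R'.edges u v u≢v) m)

    clique : List (Fin k)
    clique = filter (λ c → In? (ι c) x) (allFin k)

    clique⇒In : ∀ {c} → c ∈ clique → In (ι c) x
    clique⇒In c∈ = proj₂ (∈-filter⁻ (λ c → In? (ι c) x) {xs = allFin k} c∈)

    centre : ∃ λ x' → ∀ {c} → c ∈ clique → R'.In c x'
    -- Paths through `x` meet at `x`, so they also meet pairwise in `T'`; `c₀` supplies the node
    -- from which `helly` starts.
    centre = T'.helly R'.a R'.b (R'.a (proj₁ (liftC c₀x))) clique λ p q →
      meets (x , clique⇒In p , clique⇒In q)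

    x' = proj₁ centre

    centre∈ : ∀ {c} → In (ι c) x → R'.In c x'
    centre∈ cx = proj₂ centre (∈-filter⁺ (λ c → In? (ι c) x) (∈-allFin _) cx)

    -- By normality the paths through x form a maximal clique.
    outside : ∀ {u} → ¬ In (ι u) x → ¬ R'.In u x'
    outside {u} ¬ux ux' = ¬c₁z (Mem-convex xzt c₁x (t∈ (there (∈-filter⁺ (λ c → In? c x) (∈-allFin _) c₁x))))
      where
      C = filter (λ c → In? c x) (allFin (suc k))
      C⇒In : ∀ {c} → c ∈ C → In c x
      C⇒In c∈ = proj₂ (∈-filter⁻ (λ c → In? c x) {xs = allFin (suc k)} c∈)
      meetu : ∀ {c} → c ∈ C → Meets R (ι u) c
      meetu c∈ with liftC (C⇒In c∈)
      ... | c' , refl = meets⁻ (x' , ux' , centre∈ (C⇒In c∈))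
      swap : ∀ {u v} → Meets R u v → Meets R v u
      swap (q , p , r) = q , r , p
      pairwise : ∀ {c d} → c ∈ ι u ∷ C → d ∈ ι u ∷ C → Meets R c d
      pairwise (here refl) (here refl) = a (ι u) , (λ _ → refl) , (λ _ → refl)
      pairwise (here refl) (there d∈) = meetu d∈
      pairwise (there c∈) (here refl) = swap (meetu c∈)
      pairwise (there c∈) (there d∈) =
        x , C⇒In c∈ , C⇒In d∈
      -- If `u` contained `x'`, it would meet every path through `x`, so all of them share some `t`
      -- other than `x`. Then the neighbour of `x` towards `t` is on every path through `x`, against
      -- normality.
      common = helly a b x (ι u ∷ C) pairwise
      t = proj₁ common
      t∈ : ∀ {c} → c ∈ ι u ∷ C → In c t
      t∈ = proj₂ common
      t≢x : t ≢ x
      t≢x e = ¬ux (subst (In (ι u)) e (t∈ (here refl)))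
      xzt : Mem (hop x t) x t
      xzt = Mem-sym (Mem-hop (Mem-sym λ _ → refl) t≢x)
      witness = normal (hop-E t≢x) c₀x
      c₁x = proj₁ (proj₂ witness)
      ¬c₁z = proj₂ (proj₂ witness)

    enc = proj₁ (encoding x')

    code : Fin k → Fin (suc h)
    code u = enc (T'.hop x' (R'.a u))

    code-inj : ∀ {u w} → ¬ R'.In u x' → ¬ R'.In w x' → code u ≡ code w →
               T'.hop x' (R'.a u) ≡ T'.hop x' (R'.a w)
    code-inj ¬u ¬w = proj₂ (encoding x') (T'.hop-E (proj₂ (T'.¬Mem⇒ ¬u))) (T'.hop-E (proj₂ (T'.¬Mem⇒ ¬w)))

    -- The branch at `x` that holds the path of `v₀`. Only there could the witness from normality be
    -- `v₀`, which `R'` does not represent.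
    i₀ : Fin n
    i₀ = hop x (a v₀)

    -- Colour `zero` is the extra colour of `i₀`; it is also the default for every `i` that occurs
    -- in no conflict.
    Spec : Fin n → Fin (suc (suc h)) → Set
    Spec i κ = (κ ≡ zero × (i ≡ i₀ ⊎ ¬ (E x i × ∃ λ c → In c i)))
             ⊎ (∃ λ u → κ ≡ suc (code u) × In (ι u) i × ¬ In (ι u) x)

    spec : ∀ i → ∃ (Spec i)
    spec i with i ≟ i₀ | E? T x i ×-dec any? (λ c → In? c i)
    ... | yes p | _ = zero , inj₁ (refl , inj₁ p)
    ... | no _ | no ¬l = zero , inj₁ (refl , inj₂ ¬l)
    -- Normality is used at the node `i` against its neighbour `x`.
    ... | no i≢i₀ | yes (xi , c , ci) with normal (E-sym xi) ci
    ...   | u , ui , ¬ux with lift {u} (λ { refl → i≢i₀ (sym (branch xi ui ¬ux (λ _ → refl))) })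
    ...     | u' , refl = suc (code u') , inj₂ (u' , refl , ui , ¬ux)

    base : Fin n → Fin (suc (suc h))
    base i = proj₁ (spec i)

    -- A path with direction `i` contains `i` and so meets the path of `u`. By `sub`, read in `T'`,
    -- it meets the path of `w`, which lies in the branch of `j`.
    nested : ∀ {i j} → E x i → E x j → ∀ {u w} →
      In (ι u) i → ¬ In (ι u) x → In (ι w) j → ¬ In (ι w) x →
      (∀ {a b} → T'.Mem x' a b → (∃ λ q → T'.Mem q a b × R'.In u q) → ∃ λ q → T'.Mem q a b × R'.In w q) →
      ∀ c → Dir c i → Dir c j
    nested xi xj ui ¬ux wj ¬wx sub c ci with liftC (proj₁ ci)
    ... | c' , refl = Meets⇒Dir xj wj ¬wx (proj₁ ci)
            (meets⁻ (sub (centre∈ (proj₁ ci)) (meets (_ , Dir⇒In xi ci , ui))))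

    -- Among nodes in conflicts only `i₀` has colour `zero`. Equal positive colours put the paths of
    -- `u` and `w` in one branch at `x'`; the path of `c` meets both, so `gates-nested` applies.
    compare : ∀ {i j κ} → Conf i j → Spec i κ → Spec j κ → Pend i j ⊎ Pend j i
    compare (_ , xi , _ , c , ci , _) (inj₁ (refl , inj₂ ¬l)) _ = ⊥-elim (¬l (xi , c , Dir⇒In xi ci))
    compare (_ , _ , xj , c , _ , cj) _ (inj₁ (refl , inj₂ ¬l)) = ⊥-elim (¬l (xj , c , Dir⇒In xj cj))
    compare (i≢j , _) (inj₁ (refl , inj₁ p)) (inj₁ (_ , inj₁ q)) = ⊥-elim (i≢j (trans p (sym q)))
    compare _ (inj₁ (refl , inj₁ _)) (inj₂ (_ , () , _))
    compare cf@(i≢j , xi , xj , c , ci , cj) (inj₂ (u , refl , ui , ¬ux)) (inj₂ (w , e , wj , ¬wx))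
      with liftC (proj₁ ci)
    ... | c' , refl with gates-nested T' (outside ¬ux) (outside ¬wx)
                           (code-inj (outside ¬ux) (outside ¬wx) (suc-injective e))
                           (centre∈ (proj₁ ci)) (meets (_ , Dir⇒In xi ci , ui)) (meets (_ , Dir⇒In xj cj , wj))
    ...   | inj₁ sub = inj₂ (conf-sym cf , nested xj xi wj ¬wx ui ¬ux sub)
    ...   | inj₂ sub = inj₁ (cf , nested xi xj ui ¬ux wj ¬wx sub)

    module Rec = Recolour Conf Pend Pend? proj₁ conf-sym pend-only base
      (λ {i} {j} c e → compare c (proj₂ (spec i)) (subst (Spec j) (sym e) (proj₂ (spec j))))

  properColouring : (∀ v → InClass (suc h) (delete G v)) →
                    Σ (Fin n → Fin (suc (suc h))) (Proper R x)
  properColouring dels with any? (λ c → In? c x) | any? (λ v → ¬? (In? v x))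
  ... | no none | _ = (λ _ → zero) , proper λ v ab _ _ _ → none (v , λ eq → ⊥-elim (ab eq))
  -- Every path contains `x`, so there is no conflict: normality at a conflicting neighbour would
  -- give a path avoiding `x`.
  ... | yes _ | no all = (λ _ → zero) , proper λ v ab ax bx _ →
    let _ , xi , _ , c , ci , _ = conflict v ab ax bx
        u , _ , ¬ux = normal (E-sym xi) (Dir⇒In xi ci)
    in all (u , ¬ux)
  ... | yes (c₀ , c₀x) | yes (v₀ , ¬v₀x) = let T₀ , deg , R₀ = dels v₀ in
    Deleted.Rec.recolour v₀ ¬v₀x c₀ c₀x _ (fromVPT T₀ R₀) (λ y → degree-encoding T₀ y (deg y)) ,
    proper λ v ab ax bx →
    Deleted.Rec.recolour-proper v₀ ¬v₀x c₀ c₀x _ (fromVPT T₀ R₀) (λ y → degree-encoding T₀ y (deg y))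
      (conflict v ab ax bx)

-- Bounding the degrees

lookup-injective : ∀ {A : Set} {xs : List A} → Unique xs → ∀ {i j} → lookup xs i ≡ lookup xs j → i ≡ j
lookup-injective (_ ∷ _) {zero} {zero} _ = refl
lookup-injective {xs = _ ∷ xs} (x∉ ∷ _) {zero} {suc j} e = ⊥-elim (All.lookup x∉ (∈-lookup {xs = xs} j) e)
lookup-injective {xs = _ ∷ xs} (x∉ ∷ _) {suc i} {zero} e = ⊥-elim (All.lookup x∉ (∈-lookup {xs = xs} i) (sym e))
lookup-injective (_ ∷ u) {suc i} {suc j} e = cong suc (lookup-injective u e)

InjectiveAt : ∀ {n} {C : Set} → RTree n → Fin n → (Fin n → C) → Set
InjectiveAt T w col = ∀ {i j} → E w i → E w j → col i ≡ col j → i ≡ j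
  where open RTree T

degree-bound : ∀ {n H} (T : RTree n) w (col : Fin n → Fin H) → InjectiveAt T w col →
               degree (graph T) w ≤ H
degree-bound {n} T w col inj = injective⇒≤ {f = λ k → col (lookup L k)} λ {i} {j} e →
  lookup-injective (filter⁺ (T? ∘ graph T w) (allFin⁺ n)) (inj (nbr i) (nbr j) e)
  where
  L = filterᵇ (graph T w) (allFin n)
  nbr : ∀ k → RTree.E T w (lookup L k)
  nbr k = Adj⇒E T (Equivalence.to T-≡ (proj₂ (∈-filter⁻ (T? ∘ graph T w) {xs = allFin n} (∈-lookup {xs = L} k))))

-- B lists the nodes whose neighbours may share colours.
Node : ∀ {N} {G : Graph N} {n} {T : RTree n} → Set → Rep G T → List (Fin n) → Fin n → Set
Node {T = T} C R B w = Σ (Fin _ → C) λ col → Proper R w col × (w ∈ B ⊎ InjectiveAt T w col)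

-- By `hcong` directions may merge but not split, which only weakens properness.
proper-transfer : ∀ {N} {G : Graph N} {C : Set} {n n'} {T : RTree n} {T' : RTree n'}
  (R : Rep G T) (R' : Rep G T') (f : Fin n → Fin n') →
  (∀ v → Rep.a R' v ≡ f (Rep.a R v)) → (∀ v → Rep.b R' v ≡ f (Rep.b R v)) →
  ∀ {w} {col : Fin n → C} {col' : Fin n' → C} →
  (∀ {c d} → RTree.hop T w c ≡ RTree.hop T w d → RTree.hop T' (f w) (f c) ≡ RTree.hop T' (f w) (f d)) →
  (∀ c → col' (RTree.hop T' (f w) (f c)) ≡ col (RTree.hop T w c)) →
  Proper R w col → Proper R' (f w) col'
proper-transfer {T = T} {T'} R R' f ea eb {w} {col} {col'} hcong hcol (proper p) = proper λ v → transfer v (ea v) (eb v)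
  where
  self : ∀ {c} → RTree.hop T w c ≡ w → RTree.hop T' (f w) (f c) ≡ f w
  self {c} e = trans (hcong (trans e (sym (RTree.hop-self T w)))) (RTree.hop-self T' (f w))
  transfer : ∀ v {a' b'} → a' ≡ f (Rep.a R v) → b' ≡ f (Rep.b R v) →
    RTree.hop T' (f w) a' ≢ RTree.hop T' (f w) b' → RTree.hop T' (f w) a' ≢ f w → RTree.hop T' (f w) b' ≢ f w →
    col' (RTree.hop T' (f w) a') ≢ col' (RTree.hop T' (f w) b')
  transfer v refl refl ab aw bw eq =
    p v (ab ∘ hcong) (aw ∘ self) (bw ∘ self) (trans (sym (hcol _)) (trans eq (hcol _)))

injective⇒proper : ∀ {N} {G : Graph N} {C : Set} {n} {T : RTree n} (R : Rep G T) {w} {col : Fin n → C} →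
  InjectiveAt T w col → Proper R w col
injective⇒proper {T = T} R {w} inj = proper λ v ab aw bw e → ab (inj (nbr aw) (nbr bw) e)
  where
  open RTree T
  nbr : ∀ {c} → hop w c ≢ w → E w (hop w c)
  nbr ne = hop-E λ { refl → ne (hop-self w) }

-- Colourings under slides.

module SlideColour {n : ℕ} {T : RTree n} {x y z : Fin n}
                   (xy : RTree.E T x y) (xz : RTree.E T x z) (y≢z : y ≢ z)
                   {N : ℕ} {G : Graph N} (R : Rep G T) (R' : Rep G (Slide.Tree' T xy xz y≢z))
                   (ea : ∀ v → Rep.a R' v ≡ Rep.a R v) (eb : ∀ v → Rep.b R' v ≡ Rep.b R v)
                   {C : Set} where
  open RTree T
  open Slide T xy xz y≢z

  -- At `x` direction `y` turns into direction `z`, which is harmless since they have one colour.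
  at-x : ∀ {col : Fin n → C} → col y ≡ col z → Proper R x col → Proper R' x col
  at-x {col} cyz = proper-transfer R R' id ea eb x-cong λ c → same c (hop x c ≟ y)
    where
    same : ∀ c → Dec (hop x c ≡ y) → col (hop' x c) ≡ col (hop x c)
    same c (yes h) = trans (cong col (x-hit h)) (trans (sym cyz) (cong col (sym h)))
    same c (no h) = cong col (x-miss h)

  module _ (col : Fin n → C) where

    -- At `y` the neighbour `z` replaces `x` and inherits its colour.
    recoloured : Fin n → C
    recoloured i = if does (i ≟ z) then col x else col i

    rec-z : recoloured z ≡ col x
    rec-z rewrite dec-true (z ≟ z) refl = refl

    rec-≢ : ∀ {i} → i ≢ z → recoloured i ≡ col i
    rec-≢ {i} ne rewrite dec-false (i ≟ z) ne = refl

    at-y : Proper R y col → Proper R' y recoloured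
    at-y = proper-transfer R R' id ea eb y-cong λ c → same c (hop y c ≟ x)
      where
      same : ∀ c → Dec (hop y c ≡ x) → recoloured (hop' y c) ≡ col (hop y c)
      same c (yes h) = trans (cong recoloured (y-hit h)) (trans rec-z (cong col (sym h)))
      same c (no h) = trans (cong recoloured (y-miss h)) (rec-≢ hop-y≢z)

    E⇒≢z : ∀ {i} → E y i → i ≢ z
    E⇒≢z f refl = hop-y≢z (hop-nbr f)

    at-y-injective : InjectiveAt T y col → InjectiveAt Tree' y recoloured
    at-y-injective inj e e' eq with E'-inv e y≢z | E'-inv e' y≢z
    ... | inj₂ (_ , refl) | inj₂ (_ , refl) = refl
    ... | inj₁ (f , _ , p) | inj₂ (_ , refl) =
      ⊥-elim (p (refl , inj f (E-sym xy) (trans (sym (rec-≢ (E⇒≢z f))) (trans eq rec-z))))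
    ... | inj₂ (_ , refl) | inj₁ (f , _ , p) =
      ⊥-elim (p (refl , inj f (E-sym xy) (trans (sym (rec-≢ (E⇒≢z f))) (trans (sym eq) rec-z))))
    ... | inj₁ (f , _) | inj₁ (f' , _) = inj f f' (trans (sym (rec-≢ (E⇒≢z f))) (trans eq (rec-≢ (E⇒≢z f'))))

  slideNode : ∀ {B w} → w ≢ x → w ≢ z → Node C R B w → Node C R' B w
  slideNode {B} {w} w≢x w≢z (col , p , s) = by (w ≟ y)
    where
    by : Dec (w ≡ y) → Node C R' B w
    by (yes refl) = recoloured col , at-y col p , Sum.map id (at-y-injective col) s
    by (no w≢y) = col , proper-transfer R R' id ea eb
        (λ e → trans (other w≢x w≢y w≢z) (trans e (sym (other w≢x w≢y w≢z))))
        (λ c → cong col (other w≢x w≢y w≢z)) p ,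
      Sum.map id (λ inj e e' → inj (pre e) (pre e')) s
      where
      pre : ∀ {i} → E' w i → E w i
      pre e = [ proj₁ , (λ (q , _) → ⊥-elim (w≢y q)) ]′ (E'-inv e w≢z)

-- Splitting off a node of degree three.

module Split {N : ℕ} {G : Graph N} {h n : ℕ} {T : RTree n} (R : Rep G T)
             (x y₁ y₂ : Fin n) (xy₁ : RTree.E T x y₁) (xy₂ : RTree.E T x y₂) (y₁≢y₂ : y₁ ≢ y₂)
             (col : Fin n → Fin (suc (suc (suc h)))) (colProper : Proper R x col) (same : col y₁ ≡ col y₂) where
  open RTree T
  private
    C = Fin (suc (suc (suc h)))
    module L = Leaf T x
    T₁ = L.Tree'
    R₁ = L.leafRep R
    module S₁ = Slide T₁ (L.old xy₁) L.xl (λ ())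
    T₂ = S₁.Tree'

  extend : C → (Fin n → C) → Fin (suc n) → C
  extend κ f zero = κ
  extend κ f (suc i) = f i

  -- The leaf takes the colour of `y₁` and `y₂`. Properness then says that no path passes `x`
  -- between the leaf and either of them, as `splitRep` requires for both slides.
  col₁ : Fin (suc n) → C
  col₁ = extend (col y₁) col

  leafProper : ∀ κ w {f} → Proper R w f → Proper R₁ (suc w) (extend κ f)
  leafProper κ w p = proper-transfer R R₁ suc (λ _ → refl) (λ _ → refl) (cong suc) (λ _ → refl) p

  leafNode : ∀ {B w} → w ≢ x → Node C R B w → Node C R₁ (map suc B) (suc w)
  leafNode {w = w} w≢x (f , p , s) = extend zero f , leafProper zero w p ,
    Sum.map (∈-map⁺ suc) (λ inj → λ
      { (L.old e) (L.old e') eq → cong suc (inj e e' eq)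
      ; L.xl _ _ → ⊥-elim (w≢x refl)
      ; _ L.xl _ → ⊥-elim (w≢x refl) }) s

  apart : ∀ {m} {T : RTree m} (R : Rep G T) {x c d} {f : Fin m → C} → RTree.E T x c → RTree.E T x d → c ≢ d →
    f c ≡ f d → Proper R x f → ∀ v → ¬ (RTree.hop T x (Rep.a R v) ≡ c × RTree.hop T x (Rep.b R v) ≡ d)
  apart {T = T} R {f = f} xc xd c≢d eq (proper p) v (refl , refl) =
    p v c≢d (RTree.E-irr T xc ∘ sym) (RTree.E-irr T xd ∘ sym) eq

  empty₁ : ∀ v → Rep.In R₁ v zero → Rep.In R₁ v (suc x)
  empty₁ v m = ⊥-elim (L.leaf-empty R v m)

  R₂ : Rep G T₂
  R₂ = S₁.splitRep R₁ empty₁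
    (apart R₁ (L.old xy₁) L.xl (λ ()) refl (leafProper (col y₁) x colProper))
    (apart R₁ L.xl (L.old xy₁) (λ ()) refl (leafProper (col y₁) x colProper))

  z⊆x₂ : ∀ v → Rep.In R₂ v zero → Rep.In R₂ v (suc x)
  z⊆x₂ = S₁.splitRep-z⊆x R₁ empty₁
    (apart R₁ (L.old xy₁) L.xl (λ ()) refl (leafProper (col y₁) x colProper))
    (apart R₁ L.xl (L.old xy₁) (λ ()) refl (leafProper (col y₁) x colProper))

  module C₁ = SlideColour {T = T₁} (L.old xy₁) L.xl (λ ()) R₁ R₂ (λ _ → refl) (λ _ → refl)

  proper₂ : Proper R₂ (suc x) col₁
  proper₂ = C₁.at-x refl (leafProper (col y₁) x colProper)

  xy₂₂ : S₁.E' (suc x) (suc y₂)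
  xy₂₂ = S₁.old (L.old xy₂) (λ (_ , e) → y₁≢y₂ (sym (suc-injective e)))
                (λ (e , _) → E-irr xy₁ (suc-injective e))

  xz₂ : S₁.E' (suc x) zero
  xz₂ = S₁.old L.xl (λ ()) (λ ())

  private
    module S₂ = Slide T₂ xy₂₂ xz₂ (λ ())

  T₃ : RTree (suc n)
  T₃ = S₂.Tree'

  R₃ : Rep G T₃
  R₃ = S₂.splitRep R₂ z⊆x₂ (apart R₂ xy₂₂ xz₂ (λ ()) (sym same) proper₂)
                           (apart R₂ xz₂ xy₂₂ (λ ()) same proper₂)

  module C₂ = SlideColour {T = T₂} xy₂₂ xz₂ (λ ()) R₂ R₃ (λ _ → refl) (λ _ → refl)

  proper₃ : Proper R₃ (suc x) col₁
  proper₃ = C₂.at-x (sym same) proper₂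

  leafNbr : ∀ {i} → RTree.E T₃ zero i → i ≡ suc x ⊎ i ≡ suc y₁ ⊎ i ≡ suc y₂
  leafNbr S₂.zy = inj₂ (inj₂ refl)
  leafNbr (S₂.old S₁.zy _ _) = inj₂ (inj₁ refl)
  leafNbr (S₂.old (S₁.old L.lx _ _) _ _) = inj₁ refl

  -- Three distinct colours for `x`, `y₁` and `y₂`, the only neighbours of the new node.
  leafColour : Fin (suc n) → C
  leafColour i = if does (i ≟ suc x) then zero else if does (i ≟ suc y₁) then suc zero else suc (suc zero)

  at₀ : leafColour (suc x) ≡ zero
  at₀ rewrite dec-true (x ≟ x) refl = refl

  at₁ : leafColour (suc y₁) ≡ suc zero
  at₁ rewrite dec-false (y₁ ≟ x) (E-irr xy₁ ∘ sym) | dec-true (y₁ ≟ y₁) refl = refl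

  at₂ : leafColour (suc y₂) ≡ suc (suc zero)
  at₂ rewrite dec-false (y₂ ≟ x) (E-irr xy₂ ∘ sym) | dec-false (y₂ ≟ y₁) (y₁≢y₂ ∘ sym) = refl

  leafColour-injective : InjectiveAt T₃ zero leafColour
  leafColour-injective e e' eq with leafNbr e | leafNbr e'
  ... | inj₁ refl | inj₁ refl = refl
  ... | inj₂ (inj₁ refl) | inj₂ (inj₁ refl) = refl
  ... | inj₂ (inj₂ refl) | inj₂ (inj₂ refl) = refl
  ... | inj₁ refl | inj₂ (inj₁ refl) with () ← trans (sym at₀) (trans eq at₁)
  ... | inj₁ refl | inj₂ (inj₂ refl) with () ← trans (sym at₀) (trans eq at₂)
  ... | inj₂ (inj₁ refl) | inj₁ refl with () ← trans (sym at₁) (trans eq at₀)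
  ... | inj₂ (inj₁ refl) | inj₂ (inj₂ refl) with () ← trans (sym at₁) (trans eq at₂)
  ... | inj₂ (inj₂ refl) | inj₁ refl with () ← trans (sym at₂) (trans eq at₀)
  ... | inj₂ (inj₂ refl) | inj₂ (inj₁ refl) with () ← trans (sym at₂) (trans eq at₁)

  -- The new node is coloured injectively and joins no list; `x` stays listed, as other neighbours
  -- may still share colours.
  splitNode : ∀ {B} → (∀ w → Node C R (x ∷ B) w) → ∀ w → Node C R₃ (suc x ∷ map suc B) w
  splitNode node zero = leafColour , injective⇒proper R₃ leafColour-injective , inj₂ leafColour-injective
  splitNode {B} node (suc w) = by (w ≟ x)
    where
    by : Dec (w ≡ x) → Node C R₃ (suc x ∷ map suc B) (suc w)
    by (yes refl) = col₁ , proper₃ , inj₁ (here refl)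
    by (no w≢x) = C₂.slideNode (w≢x ∘ suc-injective) (λ ()) (C₁.slideNode (w≢x ∘ suc-injective) (λ ())
                    (leafNode w≢x (node w)))

  xNbr : ∀ {i} → RTree.E T₃ (suc x) i → i ≡ zero ⊎ ∃ λ j → i ≡ suc j × E x j × j ≢ y₁ × j ≢ y₂
  xNbr e with S₂.E'-inv e (λ ())
  ... | inj₂ (q , _) = ⊥-elim (E-irr xy₂ (suc-injective q))
  ... | inj₁ (e₁ , p₁ , _) with S₁.E'-inv e₁ (λ ())
  ...   | inj₂ (q , _) = ⊥-elim (E-irr xy₁ (suc-injective q))
  ...   | inj₁ (L.xl , _) = inj₁ refl
  ...   | inj₁ (L.old f , p , _) =
          inj₂ (_ , refl , f , (λ { refl → p (refl , refl) }) , λ { refl → p₁ (refl , refl) })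

  -- Two neighbours leave and the leaf enters, so a list covering the neighbours of `x` gets shorter
  -- with each split.
  newNbrs : List (Fin n) → List (Fin (suc n))
  newNbrs B = zero ∷ map suc (filter (λ j → ¬? (j ≟ y₁)) (filter (λ j → ¬? (j ≟ y₂)) B))

  newNbrs-covers : ∀ {B} → (∀ {i} → E x i → i ∈ B) → ∀ {i} → RTree.E T₃ (suc x) i → i ∈ newNbrs B
  newNbrs-covers cov e with xNbr e
  ... | inj₁ refl = here refl
  ... | inj₂ (j , refl , f , j≢y₁ , j≢y₂) =
    there (∈-map⁺ suc (∈-filter⁺ (λ j → ¬? (j ≟ y₁)) (∈-filter⁺ (λ j → ¬? (j ≟ y₂)) (cov f) j≢y₂) j≢y₁))

  newNbrs-shorter : ∀ {B} → (∀ {i} → E x i → i ∈ B) → length (newNbrs B) < length B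
  newNbrs-shorter {B} cov = ≤-trans
    (s≤s (≤-trans (s≤s (≤-reflexive (length-map suc (filter (λ j → ¬? (j ≟ y₁)) B₂))))
      (filter-notAll (λ j → ¬? (j ≟ y₁)) B₂ (lose (∈-filter⁺ (λ j → ¬? (j ≟ y₂)) (cov xy₁) y₁≢y₂) λ ne → ne refl))))
    (filter-notAll (λ j → ¬? (j ≟ y₂)) B (lose (cov xy₂) λ ne → ne refl))
    where B₂ = filter (λ j → ¬? (j ≟ y₂)) B

-- Repeated splitting.

module _ {N : ℕ} {G : Graph N} {h : ℕ} where

  private
    C = Fin (suc (suc (suc h)))

  finish : ∀ {n} {T : RTree n} (R : Rep G T) → (∀ w → Node C R [] w) → InClass (suc (suc (suc h))) G
  finish {T = T} R node = toTree T , bound , toVPT R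
    where
    bound : ∀ w → degree (graph T) w ≤ suc (suc (suc h))
    bound w with node w
    ... | col , _ , inj₂ inj = degree-bound T w col inj

  mutual

    -- Lexicographic recursion: `m` is the number of nodes waiting, and within it `d` bounds a list
    -- covering the neighbours of the current node. A split enlarges the tree but keeps the length
    -- of `B`.
    splitAll : ∀ m {n} {T : RTree n} (R : Rep G T) (B : List (Fin n)) → length B ≡ m →
               (∀ w → Node C R B w) → InClass (suc (suc (suc h))) G
    splitAll zero R [] _ node = finish R node
    splitAll (suc m) {n} R (x ∷ B) refl node =
      splitAt m (length (allFin n)) R x B refl (allFin n) ≤-refl (λ {i} _ → ∈-allFin i) node

    splitAt : ∀ m d {n} {T : RTree n} (R : Rep G T) (x : Fin n) (B : List (Fin n)) → length B ≡ m →
              (L : List (Fin n)) → length L ≤ d → (∀ {i} → RTree.E T x i → i ∈ L) →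
              (∀ w → Node C R (x ∷ B) w) → InClass (suc (suc (suc h))) G
    splitAt m d {n} {T} R x B len L L≤d cov node with node x
    ... | col , prop , _ with any? (λ i → any? λ j → ¬? (i ≟ j) ×-dec E? T x i ×-dec E? T x j ×-dec (col i ≟ col j))
    splitAt m d {n} {T} R x B len L L≤d cov node | col , prop , _ | no none = splitAll m R B len λ w → by w (w ≟ x)
      where
      inj : InjectiveAt T x col
      inj {i} {j} e e' eq with i ≟ j
      ... | yes p = p
      ... | no ne = ⊥-elim (none (i , j , ne , e , e' , eq))
      by : ∀ w → Dec (w ≡ x) → Node C R B w
      by w (yes refl) = col , prop , inj₂ inj
      by w (no w≢x) with node w
      ... | f , p , inj₂ s = f , p , inj₂ s
      ... | f , p , inj₁ (here e) = ⊥-elim (w≢x e)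
      ... | f , p , inj₁ (there w∈) = f , p , inj₁ w∈
    splitAt m zero R x B len L L≤d cov node | col , prop , _ | yes (i , j , i≢j , xi , xj , eq) =
      ⊥-elim (n≮0 (≤-trans (newNbrs-shorter cov) L≤d))
      where open Split {h = h} R x i j xi xj i≢j col prop eq
    splitAt m (suc d) R x B len L L≤d cov node | col , prop , _ | yes (i , j , i≢j , xi , xj , eq) =
      splitAt m d R₃ (suc x) (map suc B) (trans (length-map suc B) len) (newNbrs L)
        (s≤s⁻¹ (≤-trans (newNbrs-shorter cov) L≤d)) (newNbrs-covers cov) (splitNode node)
      where open Split {h = h} R x i j xi xj i≢j col prop eq

theorem11 : (h k : ℕ) (G : Graph (suc k)) → IsSimple G → Connected G →
    VPT G → h ≥ 3 → MinimalNon h G → InClass (suc h) G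
theorem11 (suc zero) _ _ _ _ _ (s≤s ()) _
theorem11 (suc (suc h)) k G _ _ (T , rep) _ (_ , dels) with normalise (fromVPT T rep)
-- At first every node is listed, with a proper colouring in one colour more than the degree bound
-- of the deleted subgraphs.
... | T' , R , normal = splitAll _ R (allFin _) refl λ w →
  let col , prop = Colour.properColouring (suc h) R normal w dels
  in col , prop , inj₁ (∈-allFin w)
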